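{- The following hold: (i) $2^n\cdot 41$ is an $ndh$-number for every integer $n\ge 0$. (ii) $3^n\cdot 41$ is an $ndh$-number for every integer $n\ge 0$. (iii) If $x$ is an $ndh$-number, then at least one of $2x$ and $3x$ is an $ndh$-number. (iv) Every prime $p$ with $p\equiv 41 \pmod{48}$ is an $ndh$-number.
   Context: A harmonic number is a positive integer of the form $2^a3^b$ with $a,b\ge 0$ integers (so $1$ is harmonic). A positive integer is an $ndh$-number if it cannot be written as a difference $h-k$ of two harmonic numbers $h,k$. -}

module Defs where

open import Data.Nat using (ℕ; _+_; _*_; _^_; _<_)
open import Data.Product using (∃-syntax; _×_)
open import Relation.Binary.PropositionalEquality using (_≡_)
open import Relation.Nullary using (¬_)

Harmonic : ℕ → Set
Harmonic h = ∃[ a ] ∃[ b ] h ≡ 2 ^ a * 3 ^ b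

-- x is an ndh-number iff x is a positive integer and there are no harmonic
-- h, k with x = h - k  (written over ℕ as  h ≡ x + k, since x > 0 forces h > k)
NDH : ℕ → Set
NDH x = 0 < x × ¬ (∃[ h ] ∃[ k ] Harmonic h × Harmonic k × h ≡ x + k)

{-# OPTIONS --safe #-}

-- Parts (i), (ii) and (iv) are congruence arguments modulo 41, 5, 16 and 3.
--
-- For (iii), if neither 2x nor 3x is an ndh-number then, after stripping common
-- factors, 6x = 2^A − 2^C = 3^B − 3^D with positive exponents, and one has to show
-- 6x ∈ {6, 24, 240}, so that x ∈ {1, 4, 40} is a difference of harmonic numbers.
-- This is Pillai's equation 3^B − 2^A = 3^D − 2^C, treated in the spirit of Scott.
--
-- Let v = 2^C, e = 3^D − 2^C > 0 (resp. v = 3^D, e = 2^C − 3^D > 0).  The two sides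
-- give elements √v + √−e and q^r √v + √−e (q = 2, resp. 3) whose norms are powers of
-- p = 3 (resp. 2).  Elements s√v + t√−e and s + t√(−ve) of p-power norm not divisible
-- by p form, up to sign and conjugation, a group of rank one: of two such elements the
-- one of smaller norm, or its conjugate, divides the other.  The map s√v + t√−e ↦ s/t
-- modulo q extends to a homomorphism.
-- * For q = 2, together with the parity of the grading it sends the two elements to
--   independent vectors of (ℤ/2)², which is impossible in a group of rank one.
-- * For q = 3, it vanishes on the second element but not on the first, so the second
--   is a cube, and comparing coordinates leaves only e = 5 and e = 13.
module Submission where

open import Defs
open import Data.Empty using (⊥; ⊥-elim)
open import Data.Nat using (ℕ; zero; suc; z≤n; s≤s)
open import Data.Nat.Primality using (Prime; prime?; euclidsLemma; prime⇒irreducible; prime⇒nonZero)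
open import Data.Product using (∃-syntax; _×_; _,_)
open import Data.Sum using (_⊎_; inj₁; inj₂; [_,_]′)
open import Relation.Binary.PropositionalEquality
open import Relation.Nullary using (¬_; Dec; yes; no; contradiction; ¬?; _→-dec_)
open import Relation.Nullary.Decidable using (from-yes; from-no)

module TwoTermEquations where
  open import Data.Integer using (ℤ; +_; -[1+_]; 0ℤ; 1ℤ; _+_; _*_; _-_; -_; NonZero) renaming (∣_∣ to abs)
  open import Data.Integer.DivMod using (_%ℕ_; _/ℕ_; a≡a%ℕn+[a/ℕn]*n; n%ℕd<d)
  open import Data.Integer.Divisibility.Signed hiding (quotient)
  open import Data.Integer.Properties using (pos-*; abs-*; *-comm; *-assoc; *-cancelˡ-≡; *-identityʳ; *-identityˡ; ∣i∣≡0⇒i≡0; +-injective)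
  open import Data.Integer.Tactic.RingSolver using (solve; solve-∀)
  open import Data.List using ([]; _∷_)
  import Data.Nat as ℕ
  import Data.Nat.Divisibility as ℕ
  import Data.Nat.Properties as ℕ
  import Data.Sum as Sum

  -- Prime powers and divisibility in ℤ.

  infixr 8 _^ᶻ_

  _^ᶻ_ : ℕ → ℕ → ℤ
  p ^ᶻ n = + (p ℕ.^ n)

  ^ᶻ-suc : ∀ p n → p ^ᶻ suc n ≡ + p * p ^ᶻ n
  ^ᶻ-suc p n = pos-* p (p ℕ.^ n)

  ^ᶻ-+ : ∀ p m n → p ^ᶻ (m ℕ.+ n) ≡ p ^ᶻ m * p ^ᶻ n
  ^ᶻ-+ p m n = trans (cong +_ (ℕ.^-distribˡ-+-* p m n)) (pos-* (p ℕ.^ m) (p ℕ.^ n))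

  ∣-resp : ∀ {k a b} → a ≡ b → k ∣ a → k ∣ b
  ∣-resp {k} = subst (k ∣_)

  module _ {p : ℕ} (pr : Prime p) where
    private instance _ = prime⇒nonZero pr

    euclidᶻ : ∀ a b → + p ∣ a * b → + p ∣ a ⊎ + p ∣ b
    euclidᶻ a b d = Sum.map ∣ᵤ⇒∣ ∣ᵤ⇒∣
      (euclidsLemma (abs a) (abs b) pr (subst (p ℕ∣_) (abs-* a b) (∣⇒∣ᵤ d)))
      where open import Data.Nat.Divisibility using () renaming (_∣_ to _ℕ∣_)

    ∤-* : ∀ {a b} → ¬ + p ∣ a → ¬ + p ∣ b → ¬ + p ∣ a * b
    ∤-* {a} {b} na nb d with euclidᶻ a b d
    ... | inj₁ x = na x
    ... | inj₂ x = nb x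

    ^-cancel-∤ : ∀ n {a b} → ¬ + p ∣ a → p ^ᶻ n ∣ a * b → p ^ᶻ n ∣ b
    ^-cancel-∤ zero {b = b} _ _ = divides b (solve (b ∷ []))
    ^-cancel-∤ (suc n) {a} {b} na (divides q eq) with euclidᶻ a b
        (divides (q * p ^ᶻ n) (trans eq (trans (cong (q *_) (^ᶻ-suc p n)) (rearr q (+ p) (p ^ᶻ n)))))
      where
      rearr : ∀ q p r → q * (p * r) ≡ q * r * p
      rearr = solve-∀
    ... | inj₁ d = contradiction d na
    ... | inj₂ (divides b′ refl) =
        subst₂ _∣_ (sym (^ᶻ-suc p n)) (*-comm (+ p) b′)
          (*-monoʳ-∣ (+ p) (^-cancel-∤ n na (divides q
            (*-cancelˡ-≡ (+ p) (a * b′) (q * p ^ᶻ n)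
              (trans (lhs (+ p) a b′) (trans eq (trans (cong (q *_) (^ᶻ-suc p n)) (rhs q (+ p) (p ^ᶻ n)))))))))
      where
      lhs : ∀ p a b → p * (a * b) ≡ a * (b * p)
      lhs = solve-∀
      rhs : ∀ q p r → q * (p * r) ≡ p * (q * r)
      rhs = solve-∀

    -- If `p` divided both factors it would divide their sum; so one factor is prime to `p` and the
    -- whole power goes to the other.
    ^-split : ∀ n {x y} → ¬ + p ∣ x + y → p ^ᶻ n ∣ x * y → p ^ᶻ n ∣ x ⊎ p ^ᶻ n ∣ y
    ^-split n {x} {y} ns d with + p ∣? x
    ... | no nx = inj₂ (^-cancel-∤ n nx d)
    ... | yes px = inj₁ (^-cancel-∤ n (λ py → ns (∣m∣n⇒∣m+n px py)) (∣-resp (*-comm x y) d))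

  square-pos : ∀ s → s * s ≡ + (abs s ℕ.* abs s)
  square-pos (+ n) = sym (pos-* n n)
  square-pos -[1+ n ] = refl

  -- Arithmetic of the numbers s√v + t√-e and s + t√(-ve).

  module Quadratic (v e : ℤ) where
    infixl 7 _∙_
    infixr 7 _⊙_

    -- E s t stands for s√v + t√−e and O s t for s + t√(−ve).
    data El : Set where
      E O : ℤ → ℤ → El

    -- When q ∣ v, un is the coordinate prime to q for the elements considered, and cl is
    -- s/t modulo q (squares of units are 1, so division is multiplication).
    re im un norm ty cl : El → ℤ
    re (E s t) = s
    re (O s t) = s
    im (E s t) = t
    im (O s t) = t
    un (E s t) = t
    un (O s t) = s
    norm (E s t) = v * (s * s) + e * (t * t)
    norm (O s t) = s * s + v * e * (t * t)
    ty (E _ _) = 1ℤ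
    ty (O _ _) = 0ℤ
    cl (E s t) = s * t
    cl (O s t) = - (e * (s * t))

    conj : El → El
    conj (E s t) = E s (- t)
    conj (O s t) = O s (- t)

    _⊙_ : ℤ → El → El
    k ⊙ E s t = E (k * s) (k * t)
    k ⊙ O s t = O (k * s) (k * t)

    -- Ordinary multiplication of the numbers represented. It is graded by ℤ/2, with `E` in odd and
    -- `O` in even degree, so only homogeneous elements occur.
    _∙_ : El → El → El
    E s t ∙ E s′ t′ = O (v * (s * s′) - e * (t * t′)) (s * t′ + t * s′)
    E s t ∙ O s′ t′ = E (s * s′ - e * (t * t′)) (t * s′ + v * (s * t′))
    O s t ∙ E s′ t′ = E (s * s′ - e * (t * t′)) (s * t′ + v * (t * s′))
    O s t ∙ O s′ t′ = O (s * s′ - v * e * (t * t′)) (s * t′ + t * s′)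

    norm-∙ : ∀ x y → norm (x ∙ y) ≡ norm x * norm y
    norm-∙ (E a b) (E c d) = identity v e a b c d
      where
      identity : ∀ v e a b c d → ((v * (a * c) - e * (b * d)) * (v * (a * c) - e * (b * d)) + v * e * ((a * d + b * c) * (a * d + b * c))) ≡ (v * (a * a) + e * (b * b)) * (v * (c * c) + e * (d * d))
      identity = solve-∀
    norm-∙ (E a b) (O c d) = identity v e a b c d
      where
      identity : ∀ v e a b c d → (v * ((a * c - e * (b * d)) * (a * c - e * (b * d))) + e * ((b * c + v * (a * d)) * (b * c + v * (a * d)))) ≡ (v * (a * a) + e * (b * b)) * (c * c + v * e * (d * d))
      identity = solve-∀
    norm-∙ (O a b) (E c d) = identity v e a b c d
      where
      identity : ∀ v e a b c d → (v * ((a * c - e * (b * d)) * (a * c - e * (b * d))) + e * ((a * d + v * (b * c)) * (a * d + v * (b * c)))) ≡ (a * a + v * e * (b * b)) * (v * (c * c) + e * (d * d))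
      identity = solve-∀
    norm-∙ (O a b) (O c d) = identity v e a b c d
      where
      identity : ∀ v e a b c d → ((a * c - v * e * (b * d)) * (a * c - v * e * (b * d)) + v * e * ((a * d + b * c) * (a * d + b * c))) ≡ (a * a + v * e * (b * b)) * (c * c + v * e * (d * d))
      identity = solve-∀

    norm-conj : ∀ x → norm (conj x) ≡ norm x
    norm-conj (E a b) = identity v e a b
      where
      identity : ∀ v e a b → (v * (a * a) + e * ((- b) * (- b))) ≡ (v * (a * a) + e * (b * b))
      identity = solve-∀
    norm-conj (O a b) = identity v e a b
      where
      identity : ∀ v e a b → (a * a + v * e * ((- b) * (- b))) ≡ (a * a + v * e * (b * b))
      identity = solve-∀

    norm-⊙ : ∀ k x → norm (k ⊙ x) ≡ k * k * norm x
    norm-⊙ k (E a b) = identity v e k a b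
      where
      identity : ∀ v e k a b → (v * ((k * a) * (k * a)) + e * ((k * b) * (k * b))) ≡ k * k * (v * (a * a) + e * (b * b))
      identity = solve-∀
    norm-⊙ k (O a b) = identity v e k a b
      where
      identity : ∀ v e k a b → ((k * a) * (k * a) + v * e * ((k * b) * (k * b))) ≡ k * k * (a * a + v * e * (b * b))
      identity = solve-∀

    conj-conj : ∀ x → conj (conj x) ≡ x
    conj-conj (E a b) = cong (E a) (solve (b ∷ []))
    conj-conj (O a b) = cong (O a) (solve (b ∷ []))

    -- The product of `x` and its conjugate is the integer `norm x`; in this bracketing the law
    -- serves as division by `x`.
    x∙[conjx∙y]≡normx⊙y : ∀ x y → x ∙ (conj x ∙ y) ≡ norm x ⊙ y
    x∙[conjx∙y]≡normx⊙y (E a b) (E c d) = cong₂ E (identity₁ v e a b c d) (identity₂ v e a b c d)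
      where
      identity₁ : ∀ v e a b c d → (a * (v * (a * c) - e * ((- b) * d)) - e * (b * (a * d + (- b) * c))) ≡ (v * (a * a) + e * (b * b)) * c
      identity₁ = solve-∀
      identity₂ : ∀ v e a b c d → (b * (v * (a * c) - e * ((- b) * d)) + v * (a * (a * d + (- b) * c))) ≡ (v * (a * a) + e * (b * b)) * d
      identity₂ = solve-∀
    x∙[conjx∙y]≡normx⊙y (E a b) (O c d) = cong₂ O (identity₁ v e a b c d) (identity₂ v e a b c d)
      where
      identity₁ : ∀ v e a b c d → (v * (a * (a * c - e * ((- b) * d))) - e * (b * ((- b) * c + v * (a * d)))) ≡ (v * (a * a) + e * (b * b)) * c
      identity₁ = solve-∀
      identity₂ : ∀ v e a b c d → (a * ((- b) * c + v * (a * d)) + b * (a * c - e * ((- b) * d))) ≡ (v * (a * a) + e * (b * b)) * d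
      identity₂ = solve-∀
    x∙[conjx∙y]≡normx⊙y (O a b) (E c d) = cong₂ E (identity₁ v e a b c d) (identity₂ v e a b c d)
      where
      identity₁ : ∀ v e a b c d → (a * (a * c - e * ((- b) * d)) - e * (b * (a * d + v * ((- b) * c)))) ≡ (a * a + v * e * (b * b)) * c
      identity₁ = solve-∀
      identity₂ : ∀ v e a b c d → (a * (a * d + v * ((- b) * c)) + v * (b * (a * c - e * ((- b) * d)))) ≡ (a * a + v * e * (b * b)) * d
      identity₂ = solve-∀
    x∙[conjx∙y]≡normx⊙y (O a b) (O c d) = cong₂ O (identity₁ v e a b c d) (identity₂ v e a b c d)
      where
      identity₁ : ∀ v e a b c d → (a * (a * c - v * e * ((- b) * d)) - v * e * (b * (a * d + (- b) * c))) ≡ (a * a + v * e * (b * b)) * c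
      identity₁ = solve-∀
      identity₂ : ∀ v e a b c d → (a * (a * d + (- b) * c) + b * (a * c - v * e * ((- b) * d))) ≡ (a * a + v * e * (b * b)) * d
      identity₂ = solve-∀

    ∙-⊙ : ∀ k x y → x ∙ (k ⊙ y) ≡ k ⊙ (x ∙ y)
    ∙-⊙ k (E a b) (E c d) = cong₂ O (solve (v ∷ e ∷ k ∷ a ∷ b ∷ c ∷ d ∷ [])) (solve (k ∷ a ∷ b ∷ c ∷ d ∷ []))
    ∙-⊙ k (E a b) (O c d) = cong₂ E (solve (v ∷ e ∷ k ∷ a ∷ b ∷ c ∷ d ∷ [])) (solve (v ∷ k ∷ a ∷ b ∷ c ∷ d ∷ []))
    ∙-⊙ k (O a b) (E c d) = cong₂ E (solve (v ∷ e ∷ k ∷ a ∷ b ∷ c ∷ d ∷ [])) (solve (v ∷ k ∷ a ∷ b ∷ c ∷ d ∷ []))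
    ∙-⊙ k (O a b) (O c d) = cong₂ O (solve (v ∷ e ∷ k ∷ a ∷ b ∷ c ∷ d ∷ [])) (solve (k ∷ a ∷ b ∷ c ∷ d ∷ []))

    ⊙-⊙ : ∀ k l x → k ⊙ l ⊙ x ≡ (k * l) ⊙ x
    ⊙-⊙ k l (E a b) = cong₂ E (solve (k ∷ l ∷ a ∷ [])) (solve (k ∷ l ∷ b ∷ []))
    ⊙-⊙ k l (O a b) = cong₂ O (solve (k ∷ l ∷ a ∷ [])) (solve (k ∷ l ∷ b ∷ []))

    ⊙-cancel : ∀ k .{{_ : NonZero k}} {x y} → k ⊙ x ≡ k ⊙ y → x ≡ y
    ⊙-cancel k {E a b} {E c d} eq = cong₂ E (*-cancelˡ-≡ k a c (cong re eq)) (*-cancelˡ-≡ k b d (cong im eq))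
    ⊙-cancel k {O a b} {O c d} eq = cong₂ O (*-cancelˡ-≡ k a c (cong re eq)) (*-cancelˡ-≡ k b d (cong im eq))

    -- The product of the two real parts is a difference of two squares, and this is an integer
    -- combination of `norm x` and `norm y`.
    re-product : ∀ {k} x y → k ∣ norm x → k ∣ norm y → k ∣ re (conj x ∙ y) * re (x ∙ y)
    re-product {k} (E a b) (E c d) dx dy = ∣-resp (identity v e a b c d)
      (∣m∣n⇒∣m-n (∣n⇒∣m*n (v * (c * c)) dx) (∣n⇒∣m*n (e * (b * b)) dy))
      where
      identity : ∀ v e a b c d → v * (c * c) * (v * (a * a) + e * (b * b)) - e * (b * b) * (v * (c * c) + e * (d * d)) ≡ (v * (a * c) - e * (- b * d)) * (v * (a * c) - e * (b * d))
      identity = solve-∀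
    re-product {k} (E a b) (O c d) dx dy = ∣-resp (identity v e a b c d)
      (∣m∣n⇒∣m-n (∣n⇒∣m*n (a * a) dy) (∣n⇒∣m*n (e * (d * d)) dx))
      where
      identity : ∀ v e a b c d → a * a * (c * c + v * e * (d * d)) - e * (d * d) * (v * (a * a) + e * (b * b)) ≡ (a * c - e * (- b * d)) * (a * c - e * (b * d))
      identity = solve-∀
    re-product {k} (O a b) (E c d) dx dy = ∣-resp (identity v e a b c d)
      (∣m∣n⇒∣m-n (∣n⇒∣m*n (c * c) dx) (∣n⇒∣m*n (e * (b * b)) dy))
      where
      identity : ∀ v e a b c d → c * c * (a * a + v * e * (b * b)) - e * (b * b) * (v * (c * c) + e * (d * d)) ≡ (a * c - e * (- b * d)) * (a * c - e * (b * d))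
      identity = solve-∀
    re-product {k} (O a b) (O c d) dx dy = ∣-resp (identity v e a b c d)
      (∣m∣n⇒∣m-n (∣n⇒∣m*n (c * c) dx) (∣n⇒∣m*n (v * e * (b * b)) dy))
      where
      identity : ∀ v e a b c d → c * c * (a * a + v * e * (b * b)) - v * e * (b * b) * (c * c + v * e * (d * d)) ≡ (a * c - v * e * (- b * d)) * (a * c - v * e * (b * d))
      identity = solve-∀

    -- Two leading terms of kind `E` contribute √v · √v = v.
    re-factor : El → El → ℤ
    re-factor (E _ _) (E _ _) = v
    re-factor _ _ = 1ℤ

    -- Conjugating `x` flips the sign of the term in `im x * im y`, so only the leading terms
    -- survive. Together with `re-product` this decides which of `conj x ∙ y` and `x ∙ y` absorbs a
    -- prime power.
    re-sum : ∀ x y → re (conj x ∙ y) + re (x ∙ y) ≡ + 2 * (re-factor x y * (re x * re y))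
    re-sum (E a b) (E c d) = identity v e a b c d
      where
      identity : ∀ v e a b c d → (v * (a * c) - e * ((- b) * d)) + (v * (a * c) - e * (b * d)) ≡ + 2 * (v * (a * c))
      identity = solve-∀
    re-sum (E a b) (O c d) = identity v e a b c d
      where
      identity : ∀ v e a b c d → (a * c - e * ((- b) * d)) + (a * c - e * (b * d)) ≡ + 2 * (1ℤ * (a * c))
      identity = solve-∀
    re-sum (O a b) (E c d) = identity v e a b c d
      where
      identity : ∀ v e a b c d → (a * c - e * ((- b) * d)) + (a * c - e * (b * d)) ≡ + 2 * (1ℤ * (a * c))
      identity = solve-∀
    re-sum (O a b) (O c d) = identity v e a b c d
      where
      identity : ∀ v e a b c d → (a * c - v * e * ((- b) * d)) + (a * c - v * e * (b * d)) ≡ + 2 * (1ℤ * (a * c))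
      identity = solve-∀

    -- Eliminating between `norm x` and the real part of `conj x ∙ y` leaves the imaginary part
    -- times `re x`, with a further factor `v` for two `E`s; these factors cancel modulo `r` by
    -- hypothesis.
    im∣ : ∀ {r} x y → (∀ z → r ∣ v * z → r ∣ z) → (∀ z → r ∣ re x * z → r ∣ z) →
      r ∣ norm x → r ∣ re (conj x ∙ y) → r ∣ im (conj x ∙ y)
    im∣ {r} (E a b) (E c d) cv cx dn dr = cx _ (cv _ (∣-resp (identity v e a b c d)
        (∣m∣n⇒∣m-n (∣m⇒∣m*n d dn) (∣n⇒∣m*n b dr))))
      where
      identity : ∀ v e a b c d → (v * (a * a) + e * (b * b)) * d - b * (v * (a * c) - e * (- b * d)) ≡ v * (a * (a * d + - b * c))
      identity = solve-∀
    im∣ {r} (E a b) (O c d) cv cx dn dr = cx _ (∣-resp (identity v e a b c d)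
        (∣m∣n⇒∣m-n (∣m⇒∣m*n d dn) (∣n⇒∣m*n b dr)))
      where
      identity : ∀ v e a b c d → (v * (a * a) + e * (b * b)) * d - b * (a * c - e * (- b * d)) ≡ a * (- b * c + v * (a * d))
      identity = solve-∀
    im∣ {r} (O a b) (E c d) cv cx dn dr = cx _ (∣-resp (identity v e a b c d)
        (∣m∣n⇒∣m-n (∣m⇒∣m*n d dn) (∣n⇒∣m*n (v * b) dr)))
      where
      identity : ∀ v e a b c d → (a * a + v * e * (b * b)) * d - v * b * (a * c - e * (- b * d)) ≡ a * (a * d + v * (- b * c))
      identity = solve-∀
    im∣ {r} (O a b) (O c d) cv cx dn dr = cx _ (∣-resp (identity v e a b c d)
        (∣m∣n⇒∣m-n (∣m⇒∣m*n d dn) (∣n⇒∣m*n b dr)))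
      where
      identity : ∀ v e a b c d → (a * a + v * e * (b * b)) * d - b * (a * c - v * e * (- b * d)) ≡ a * (a * d + - b * c)
      identity = solve-∀

    ⊙-quotient : ∀ {r} x → r ∣ re x → r ∣ im x → ∃[ z ] x ≡ r ⊙ z
    ⊙-quotient {r} (E s t) (divides a p) (divides b q) = E a b , cong₂ E (trans p (*-comm a r)) (trans q (*-comm b r))
    ⊙-quotient {r} (O s t) (divides a p) (divides b q) = O a b , cong₂ O (trans p (*-comm a r)) (trans q (*-comm b r))

    -- The candidate for y/x is `conj x ∙ y` divided by `r`. The factor `λ′` is what remains of
    -- `norm x` after that division: 1 for powers of 3, and 2 for powers of 2, where one factor 2
    -- cannot be removed.
    quotient : ∀ {r λ′ K} .{{_ : NonZero r}} x y →
      (∀ z → r ∣ v * z → r ∣ z) → (∀ z → r ∣ re x * z → r ∣ z) →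
      norm x ≡ r * λ′ → norm y ≡ r * (λ′ * K) → r ∣ re (conj x ∙ y) →
      ∃[ z ] conj x ∙ y ≡ r ⊙ z × x ∙ z ≡ λ′ ⊙ y × norm z ≡ λ′ * λ′ * K
    quotient {r} {l} {K} x y cv cx nx ny dr with ⊙-quotient (conj x ∙ y) dr
        (im∣ x y cv cx (divides l (trans nx (*-comm r l))) dr)
    ... | z , eq = z , eq
        , ⊙-cancel r (trans (sym (∙-⊙ r x z)) (trans (cong (x ∙_) (sym eq)) (trans (x∙[conjx∙y]≡normx⊙y x y)
            (trans (cong (_⊙ y) nx) (sym (⊙-⊙ r l y))))))
        , *-cancelˡ-≡ r _ _ (*-cancelˡ-≡ r _ _ (begin
            r * (r * norm z) ≡⟨ *-assoc r r (norm z) ⟨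
            r * r * norm z ≡⟨ norm-⊙ r z ⟨
            norm (r ⊙ z) ≡⟨ cong norm eq ⟨
            norm (conj x ∙ y) ≡⟨ norm-∙ (conj x) y ⟩
            norm (conj x) * norm y ≡⟨ cong₂ _*_ (trans (norm-conj x) nx) ny ⟩
            r * l * (r * (l * K)) ≡⟨ solve (r ∷ l ∷ K ∷ []) ⟩
            r * (r * (l * l * K)) ∎))
      where open ≡-Reasoning

    re-⊙ : ∀ k x → re (k ⊙ x) ≡ k * re x
    re-⊙ k (E _ _) = refl
    re-⊙ k (O _ _) = refl

    re-conj : ∀ x → re (conj x) ≡ re x
    re-conj (E _ _) = refl
    re-conj (O _ _) = refl

    module _ {p : ℕ} (pr : Prime p) (¬p∣v : ¬ + p ∣ v) (¬p∣e : ¬ + p ∣ e) where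
      private
        square : ∀ a → + p ∣ a * a → + p ∣ a
        square a d = Sum.reduce (euclidᶻ pr a a d)

        strip : ∀ {a} b → ¬ + p ∣ a → + p ∣ a * b → + p ∣ b
        strip b na d = Sum.fromInj₂ (λ d′ → contradiction d′ na) (euclidᶻ pr _ b d)

      -- With `v` and `e` prime to `p`, a norm divisible by `p` has either both coordinates
      -- divisible by `p` or neither.
      ∣im : ∀ x → + p ∣ norm x → + p ∣ re x → + p ∣ im x
      ∣im (E s t) dn ds = square t (strip (t * t) ¬p∣e (∣m+n∣m⇒∣n dn (∣n⇒∣m*n v (∣m⇒∣m*n s ds))))
      ∣im (O s t) dn ds = square t (strip (t * t) (∤-* pr ¬p∣v ¬p∣e) (∣m+n∣m⇒∣n dn (∣m⇒∣m*n s ds)))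

      ∣re : ∀ x → + p ∣ norm x → + p ∣ im x → + p ∣ re x
      ∣re (E s t) dn dt = square s (strip (s * s) ¬p∣v (∣m+n∣n⇒∣m dn (∣n⇒∣m*n e (∣m⇒∣m*n t dt))))
      ∣re (O s t) dn dt = square s (∣m+n∣n⇒∣m dn (∣n⇒∣m*n (v * e) (∣m⇒∣m*n t dt)))

    ∙-comm : ∀ x y → x ∙ y ≡ y ∙ x
    ∙-comm (E a b) (E c d) = cong₂ O (solve (v ∷ e ∷ a ∷ b ∷ c ∷ d ∷ [])) (solve (v ∷ e ∷ a ∷ b ∷ c ∷ d ∷ []))
    ∙-comm (E a b) (O c d) = cong₂ E (solve (v ∷ e ∷ a ∷ b ∷ c ∷ d ∷ [])) (solve (v ∷ e ∷ a ∷ b ∷ c ∷ d ∷ []))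
    ∙-comm (O a b) (E c d) = cong₂ E (solve (v ∷ e ∷ a ∷ b ∷ c ∷ d ∷ [])) (solve (v ∷ e ∷ a ∷ b ∷ c ∷ d ∷ []))
    ∙-comm (O a b) (O c d) = cong₂ O (solve (v ∷ e ∷ a ∷ b ∷ c ∷ d ∷ [])) (solve (v ∷ e ∷ a ∷ b ∷ c ∷ d ∷ []))

    ∙-assoc : ∀ x y z → x ∙ y ∙ z ≡ x ∙ (y ∙ z)
    ∙-assoc (E a b) (E c d) (E f g) = cong₂ E (solve (v ∷ e ∷ a ∷ b ∷ c ∷ d ∷ f ∷ g ∷ [])) (solve (v ∷ e ∷ a ∷ b ∷ c ∷ d ∷ f ∷ g ∷ []))
    ∙-assoc (E a b) (E c d) (O f g) = cong₂ O (solve (v ∷ e ∷ a ∷ b ∷ c ∷ d ∷ f ∷ g ∷ [])) (solve (v ∷ e ∷ a ∷ b ∷ c ∷ d ∷ f ∷ g ∷ []))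
    ∙-assoc (E a b) (O c d) (E f g) = cong₂ O (solve (v ∷ e ∷ a ∷ b ∷ c ∷ d ∷ f ∷ g ∷ [])) (solve (v ∷ e ∷ a ∷ b ∷ c ∷ d ∷ f ∷ g ∷ []))
    ∙-assoc (E a b) (O c d) (O f g) = cong₂ E (solve (v ∷ e ∷ a ∷ b ∷ c ∷ d ∷ f ∷ g ∷ [])) (solve (v ∷ e ∷ a ∷ b ∷ c ∷ d ∷ f ∷ g ∷ []))
    ∙-assoc (O a b) (E c d) (E f g) = cong₂ O (solve (v ∷ e ∷ a ∷ b ∷ c ∷ d ∷ f ∷ g ∷ [])) (solve (v ∷ e ∷ a ∷ b ∷ c ∷ d ∷ f ∷ g ∷ []))
    ∙-assoc (O a b) (E c d) (O f g) = cong₂ E (solve (v ∷ e ∷ a ∷ b ∷ c ∷ d ∷ f ∷ g ∷ [])) (solve (v ∷ e ∷ a ∷ b ∷ c ∷ d ∷ f ∷ g ∷ []))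
    ∙-assoc (O a b) (O c d) (E f g) = cong₂ E (solve (v ∷ e ∷ a ∷ b ∷ c ∷ d ∷ f ∷ g ∷ [])) (solve (v ∷ e ∷ a ∷ b ∷ c ∷ d ∷ f ∷ g ∷ []))
    ∙-assoc (O a b) (O c d) (O f g) = cong₂ O (solve (v ∷ e ∷ a ∷ b ∷ c ∷ d ∷ f ∷ g ∷ [])) (solve (v ∷ e ∷ a ∷ b ∷ c ∷ d ∷ f ∷ g ∷ []))

    conj-∙ : ∀ x y → conj (x ∙ y) ≡ conj x ∙ conj y
    conj-∙ (E a b) (E c d) = cong₂ O (solve (v ∷ e ∷ a ∷ b ∷ c ∷ d ∷ [])) (solve (v ∷ e ∷ a ∷ b ∷ c ∷ d ∷ []))
    conj-∙ (E a b) (O c d) = cong₂ E (solve (v ∷ e ∷ a ∷ b ∷ c ∷ d ∷ [])) (solve (v ∷ e ∷ a ∷ b ∷ c ∷ d ∷ []))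
    conj-∙ (O a b) (E c d) = cong₂ E (solve (v ∷ e ∷ a ∷ b ∷ c ∷ d ∷ [])) (solve (v ∷ e ∷ a ∷ b ∷ c ∷ d ∷ []))
    conj-∙ (O a b) (O c d) = cong₂ O (solve (v ∷ e ∷ a ∷ b ∷ c ∷ d ∷ [])) (solve (v ∷ e ∷ a ∷ b ∷ c ∷ d ∷ []))

    conj-⊙ : ∀ k x → conj (k ⊙ x) ≡ k ⊙ conj x
    conj-⊙ k (E a b) = cong (E (k * a)) (solve (k ∷ b ∷ []))
    conj-⊙ k (O a b) = cong (O (k * a)) (solve (k ∷ b ∷ []))

  -- The norm as a sum of natural numbers, for the size comparisons that pin down the elements of
  -- norm 1 and 4.
  norm-E : ∀ v e s t → Quadratic.norm (+ v) (+ e) (Quadratic.E s t) ≡ + (v ℕ.* (abs s ℕ.* abs s) ℕ.+ e ℕ.* (abs t ℕ.* abs t))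
  norm-E v e s t rewrite square-pos s | square-pos t =
    cong₂ _+_ (sym (pos-* v _)) (sym (pos-* e _))

  norm-O : ∀ v e s t → Quadratic.norm (+ v) (+ e) (Quadratic.O s t) ≡ + (abs s ℕ.* abs s ℕ.+ v ℕ.* e ℕ.* (abs t ℕ.* abs t))
  norm-O v e s t rewrite square-pos s | square-pos t | sym (pos-* v e) =
    cong (λ w → + (abs s ℕ.* abs s) + w) (sym (pos-* (v ℕ.* e) _))

  -- The class homomorphism modulo q.

  module Classes (v e : ℤ) {q : ℕ} (pr : Prime q) (q∣v : + q ∣ v) (¬q∣e : ¬ + q ∣ e)
      (square≡1 : ∀ a → ¬ + q ∣ a → + q ∣ a * a - 1ℤ) where
    open Quadratic v e

    -- Modulo `q` all terms with a factor `v` drop out and squares of units become 1. What remains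
    -- is additivity of s/t on `E` and of its counterpart -e t/s on `O`.
    cl-∙ : ∀ x y → ¬ + q ∣ un x → ¬ + q ∣ un y → + q ∣ cl (x ∙ y) - (cl x + cl y)
    cl-∙ (E a b) (E c d) u u′ = ∣-resp (identity v e a b c d)
        (∣m∣n⇒∣m+n (∣m∣n⇒∣m+n (∣m⇒∣m*n (a * b) (square≡1 (e * d) (∤-* pr ¬q∣e u′))) (∣m⇒∣m*n (c * d) (square≡1 (e * b) (∤-* pr ¬q∣e u)))) (∣m⇒∣m*n (- (e * ((a * d + b * c) * (a * c)))) q∣v))
      where
      identity : ∀ v e a b c d → ((e * d) * (e * d) - 1ℤ) * (a * b) + ((e * b) * (e * b) - 1ℤ) * (c * d) + v * (- (e * ((a * d + b * c) * (a * c)))) ≡ (- (e * ((v * (a * c) - e * (b * d)) * (a * d + b * c)))) - ((a * b) + (c * d))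
      identity = solve-∀
    cl-∙ (E a b) (O c d) u u′ = ∣-resp (identity v e a b c d)
        (∣m∣n⇒∣m+n (∣m∣n⇒∣m+n (∣m⇒∣m*n (a * b) (square≡1 c u′)) (∣m⇒∣m*n (- (e * (c * d))) (square≡1 b u))) (∣m⇒∣m*n ((a * c - e * (b * d)) * (a * d)) q∣v))
      where
      identity : ∀ v e a b c d → (c * c - 1ℤ) * (a * b) + (b * b - 1ℤ) * (- (e * (c * d))) + v * ((a * c - e * (b * d)) * (a * d)) ≡ ((a * c - e * (b * d)) * (b * c + v * (a * d))) - ((a * b) + (- (e * (c * d))))
      identity = solve-∀
    cl-∙ (O a b) (E c d) u u′ = ∣-resp (identity v e a b c d)
        (∣m∣n⇒∣m+n (∣m∣n⇒∣m+n (∣m⇒∣m*n (- (e * (a * b))) (square≡1 d u′)) (∣m⇒∣m*n (c * d) (square≡1 a u))) (∣m⇒∣m*n ((a * c - e * (b * d)) * (b * c)) q∣v))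
      where
      identity : ∀ v e a b c d → (d * d - 1ℤ) * (- (e * (a * b))) + (a * a - 1ℤ) * (c * d) + v * ((a * c - e * (b * d)) * (b * c)) ≡ ((a * c - e * (b * d)) * (a * d + v * (b * c))) - ((- (e * (a * b))) + (c * d))
      identity = solve-∀
    cl-∙ (O a b) (O c d) u u′ = ∣-resp (identity v e a b c d)
        (∣m∣n⇒∣m+n (∣m∣n⇒∣m+n (∣m⇒∣m*n (- (e * (a * b))) (square≡1 c u′)) (∣m⇒∣m*n (- (e * (c * d))) (square≡1 a u))) (∣m⇒∣m*n (e * e * ((a * d + b * c) * (b * d))) q∣v))
      where
      identity : ∀ v e a b c d → (c * c - 1ℤ) * (- (e * (a * b))) + (a * a - 1ℤ) * (- (e * (c * d))) + v * (e * e * ((a * d + b * c) * (b * d))) ≡ (- (e * ((a * c - v * e * (b * d)) * (a * d + b * c)))) - ((- (e * (a * b))) + (- (e * (c * d))))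
      identity = solve-∀

    un-∙ : ∀ x y → ¬ + q ∣ un x → ¬ + q ∣ un y → ¬ + q ∣ un (x ∙ y)
    un-∙ (E a b) (E c d) u u′ d′ = ∤-* pr ¬q∣e (∤-* pr u u′) (∣-resp (identity v e a b c d)
        (∣m⇒∣-m (∣m∣n⇒∣m+n d′ (∣m⇒∣m*n (- (a * c)) q∣v))))
      where
      identity : ∀ v e a b c d → - ((v * (a * c) - e * (b * d)) + v * (- (a * c))) ≡ e * (b * d)
      identity = solve-∀
    un-∙ (E a b) (O c d) u u′ d′ = ∤-* pr u u′ (∣-resp (identity v e a b c d)
        (∣m∣n⇒∣m+n d′ (∣m⇒∣m*n (- (a * d)) q∣v)))
      where
      identity : ∀ v e a b c d → (b * c + v * (a * d)) + v * (- (a * d)) ≡ b * c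
      identity = solve-∀
    un-∙ (O a b) (E c d) u u′ d′ = ∤-* pr u u′ (∣-resp (identity v e a b c d)
        (∣m∣n⇒∣m+n d′ (∣m⇒∣m*n (- (b * c)) q∣v)))
      where
      identity : ∀ v e a b c d → (a * d + v * (b * c)) + v * (- (b * c)) ≡ a * d
      identity = solve-∀
    un-∙ (O a b) (O c d) u u′ d′ = ∤-* pr u u′ (∣-resp (identity v e a b c d)
        (∣m∣n⇒∣m+n d′ (∣m⇒∣m*n (e * (b * d)) q∣v)))
      where
      identity : ∀ v e a b c d → (a * c - v * e * (b * d)) + v * (e * (b * d)) ≡ a * c
      identity = solve-∀

    cl-conj : ∀ x → cl (conj x) ≡ - cl x
    cl-conj (E a b) = identity a b
      where
      identity : ∀ a b → a * - b ≡ - (a * b)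
      identity = solve-∀
    cl-conj (O a b) = identity e a b
      where
      identity : ∀ e a b → - (e * (a * - b)) ≡ - - (e * (a * b))
      identity = solve-∀

    un-conj : ∀ x → ¬ + q ∣ un x → ¬ + q ∣ un (conj x)
    un-conj (E a b) u d = u (∣-resp (identity b) (∣m⇒∣-m d))
      where
      identity : ∀ b → - - b ≡ b
      identity = solve-∀
    un-conj (O a b) u = u

    un-⊙ : ∀ k x → un (k ⊙ x) ≡ k * un x
    un-⊙ k (E a b) = refl
    un-⊙ k (O a b) = refl

    cl-⊙ : ∀ k x → cl (k ⊙ x) ≡ k * k * cl x
    cl-⊙ k (E a b) = identity k a b
      where
      identity : ∀ k a b → k * a * (k * b) ≡ k * k * (a * b)
      identity = solve-∀
    cl-⊙ k (O a b) = identity e k a b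
      where
      identity : ∀ e k a b → - (e * (k * a * (k * b))) ≡ k * k * - (e * (a * b))
      identity = solve-∀

    un-quotient : ∀ {r} x y z → conj x ∙ y ≡ r ⊙ z → ¬ + q ∣ un x → ¬ + q ∣ un y → ¬ + q ∣ un z
    un-quotient {r} x y z eq u u′ d = un-∙ (conj x) y (un-conj x u) u′
      (∣-resp (trans (sym (un-⊙ r z)) (cong un (sym eq))) (∣n⇒∣m*n r d))

    -- Conjugation negates the class, and scaling by `r` multiplies it by `r * r`, which is 1 modulo
    -- `q`.
    cl-quotient : ∀ {r} x y z → ¬ + q ∣ r → conj x ∙ y ≡ r ⊙ z → ¬ + q ∣ un x → ¬ + q ∣ un y →
      + q ∣ cl z - (cl y - cl x)
    cl-quotient {r} x y z nr eq u u′ = ∣-resp (identity (cl z) (cl x) (cl y) r)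
      (∣m∣n⇒∣m-n
        (subst₂ (λ a b → + q ∣ a - (b + cl y)) (trans (cong cl eq) (cl-⊙ r z)) (cl-conj x)
          (cl-∙ (conj x) y (un-conj x u) u′))
        (∣m⇒∣m*n (cl z) (square≡1 r nr)))
      where
      identity : ∀ z x y r → r * r * z - (- x + y) - (r * r - 1ℤ) * z ≡ z - (y - x)
      identity = solve-∀

  -- Residues modulo 2 and 3.

  prime2 : Prime 2
  prime2 = from-yes (prime? 2)

  prime3 : Prime 3
  prime3 = from-yes (prime? 3)

  data Mod2 (a : ℤ) : Set where
    r0 : ∀ b → a ≡ b * + 2 → Mod2 a
    r1 : ∀ b → a ≡ 1ℤ + b * + 2 → Mod2 a

  data Mod3 (a : ℤ) : Set where
    r0 : ∀ b → a ≡ b * + 3 → Mod3 a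
    r1 : ∀ b → a ≡ 1ℤ + b * + 3 → Mod3 a
    r2 : ∀ b → a ≡ - 1ℤ + b * + 3 → Mod3 a

  mod2 : ∀ a → Mod2 a
  mod2 a with a %ℕ 2 | a≡a%ℕn+[a/ℕn]*n a 2 | n%ℕd<d a 2
  ... | 0 | eq | _ = r0 (a /ℕ 2) (trans eq (identity (a /ℕ 2 * + 2)))
    where
    identity : ∀ x → + 0 + x ≡ x
    identity = solve-∀
  ... | 1 | eq | _ = r1 (a /ℕ 2) eq
  ... | suc (suc _) | _ | s≤s (s≤s ())

  mod3 : ∀ a → Mod3 a
  mod3 a with a %ℕ 3 | a≡a%ℕn+[a/ℕn]*n a 3 | n%ℕd<d a 3
  ... | 0 | eq | _ = r0 (a /ℕ 3) (trans eq (identity (a /ℕ 3 * + 3)))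
    where
    identity : ∀ x → + 0 + x ≡ x
    identity = solve-∀
  ... | 1 | eq | _ = r1 (a /ℕ 3) eq
  ... | 2 | eq | _ = r2 (1ℤ + a /ℕ 3) (trans eq (identity (a /ℕ 3)))
    where
    identity : ∀ x → + 2 + x * + 3 ≡ - 1ℤ + (1ℤ + x) * + 3
    identity = solve-∀
  ... | suc (suc (suc _)) | _ | s≤s (s≤s (s≤s ()))

  square≡1-mod2 : ∀ a → ¬ + 2 ∣ a → + 2 ∣ a * a - 1ℤ
  square≡1-mod2 a na with mod2 a
  ... | r0 b eq = contradiction (divides b eq) na
  ... | r1 b refl = divides (+ 2 * b + + 2 * b * b) (identity b)
    where
    identity : ∀ b → (1ℤ + b * + 2) * (1ℤ + b * + 2) - 1ℤ ≡ (+ 2 * b + + 2 * b * b) * + 2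
    identity = solve-∀

  square≡1-mod3 : ∀ a → ¬ + 3 ∣ a → + 3 ∣ a * a - 1ℤ
  square≡1-mod3 a na with mod3 a
  ... | r0 b eq = contradiction (divides b eq) na
  ... | r1 b refl = divides (+ 2 * b + + 3 * b * b) (identity b)
    where
    identity : ∀ b → (1ℤ + b * + 3) * (1ℤ + b * + 3) - 1ℤ ≡ (+ 2 * b + + 3 * b * b) * + 3
    identity = solve-∀
  ... | r2 b refl = divides (- (+ 2 * b) + + 3 * b * b) (identity b)
    where
    identity : ∀ b → (- 1ℤ + b * + 3) * (- 1ℤ + b * + 3) - 1ℤ ≡ (- (+ 2 * b) + + 3 * b * b) * + 3
    identity = solve-∀

  ∤-^ : ∀ {p q} → Prime p → ¬ + p ∣ + q → ∀ n → 1 ℕ.< p → ¬ + p ∣ q ^ᶻ n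
  ∤-^ pr nd zero lt d = contradiction (ℕ.∣1⇒≡1 (∣⇒∣ᵤ d)) (λ eq → ℕ.<-irrefl (sym eq) lt)
  ∤-^ {q = q} pr nd (suc n) lt d = ∤-* pr nd (∤-^ pr nd n lt) (∣-resp (^ᶻ-suc q n) d)

  -- Elements whose norm is a power of 3.

  module NormPowerOf3 (v₀ e₀ : ℕ) (1≤v : 1 ℕ.≤ v₀) (2≤e : 2 ℕ.≤ e₀)
      (2∣v : + 2 ∣ + v₀) (¬2∣e : ¬ + 2 ∣ + e₀) (¬3∣v : ¬ + 3 ∣ + v₀) (¬3∣e : ¬ + 3 ∣ + e₀) where
    v e : ℤ
    v = + v₀
    e = + e₀
    open Quadratic v e
    open Classes v e prime2 2∣v ¬2∣e square≡1-mod2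

    -- `¬3∣re` makes the element primitive at 3, and `¬2∣un` ensures that it has a class modulo 2.
    record Good (n : ℕ) (x : El) : Set where
      constructor good
      field
        norm≡ : norm x ≡ 3 ^ᶻ n
        ¬3∣re : ¬ + 3 ∣ re x
        ¬2∣un : ¬ + 2 ∣ un x
    open Good

    Good-conj : ∀ {n x} → Good n x → Good n (conj x)
    Good-conj {x = x} (good a b c) = good (trans (norm-conj x) a)
      (λ d → b (∣-resp (re-conj x) d)) (un-conj x c)

    -- A nonzero `t` contributes at least `e₀`, respectively `v₀ * e₀`, hence at least 2. With `t`
    -- zero, kind `E` is excluded because `un` is odd, and an integer of trivial class remains.
    norm1 : ∀ x → ¬ + 2 ∣ un x → norm x ≡ 1ℤ → ty x ≡ 0ℤ × cl x ≡ 0ℤ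
    norm1 (E s t) u eq with abs t in teq | trans (sym (norm-E v₀ e₀ s t)) eq
    ... | zero | _ = contradiction (divides 0ℤ (∣i∣≡0⇒i≡0 teq)) u
    ... | suc b | eq′ = ⊥-elim (ℕ.<-irrefl (sym (+-injective eq′))
          (ℕ.≤-trans 2≤e (ℕ.≤-trans (ℕ.m≤m*n e₀ _) (ℕ.m≤n+m _ _))))
    norm1 (O s t) u eq with abs t in teq | trans (sym (norm-O v₀ e₀ s t)) eq
    ... | zero | _ rewrite ∣i∣≡0⇒i≡0 {t} teq = refl , identity e s
      where
      identity : ∀ e s → - (e * (s * 0ℤ)) ≡ 0ℤ
      identity = solve-∀
    ... | suc b | eq′ = ⊥-elim (ℕ.<-irrefl (sym (+-injective eq′))
          (ℕ.≤-trans (ℕ.*-mono-≤ 1≤v 2≤e) (ℕ.≤-trans (ℕ.m≤m*n (v₀ ℕ.* e₀) _) (ℕ.m≤n+m _ _))))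

    ty-∙ : ∀ x y → + 2 ∣ ty (x ∙ y) - (ty x + ty y)
    ty-∙ (E _ _) (E _ _) = divides -[1+ 0 ] refl
    ty-∙ (E _ _) (O _ _) = divides 0ℤ refl
    ty-∙ (O _ _) (E _ _) = divides 0ℤ refl
    ty-∙ (O _ _) (O _ _) = divides 0ℤ refl

    ty-conj : ∀ x → ty (conj x) ≡ ty x
    ty-conj (E _ _) = refl
    ty-conj (O _ _) = refl

    ¬3∣re-factor : ∀ x y → ¬ + 3 ∣ re-factor x y
    ¬3∣re-factor (E _ _) (E _ _) = ¬3∣v
    ¬3∣re-factor (E _ _) (O _ _) = from-no (+ 3 ∣? 1ℤ)
    ¬3∣re-factor (O _ _) (E _ _) = from-no (+ 3 ∣? 1ℤ)
    ¬3∣re-factor (O _ _) (O _ _) = from-no (+ 3 ∣? 1ℤ)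

    -- The product of the two real parts is divisible by the full power of 3, while their sum is
    -- prime to 3. Hence `x` or its conjugate divides `y`.
    split : ∀ {n k x y} → Good n x → Good (n ℕ.+ k) y → 3 ^ᶻ n ∣ re (conj x ∙ y) ⊎ 3 ^ᶻ n ∣ re (x ∙ y)
    split {n} {k} {x} {y} gx gy = ^-split prime3 n
      (λ d → ∤-* prime3 (from-no (+ 3 ∣? + 2)) (∤-* prime3 (¬3∣re-factor x y) (∤-* prime3 (¬3∣re gx) (¬3∣re gy)))
        (∣-resp (re-sum x y) d))
      (re-product x y (∣-resp (sym (norm≡ gx)) ∣-refl)
        (∣-resp (trans (sym (^ᶻ-+ 3 n k)) (sym (norm≡ gy))) (∣m⇒∣m*n (3 ^ᶻ k) ∣-refl)))

    -- The determinant of the images of x and y in (ℤ/2)².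
    det : El → El → ℤ
    det x y = ty x * cl y - ty y * cl x

    -- Degree and class of the quotient are those of `y` minus those of `x`, and subtracting one
    -- vector from the other preserves a determinant.
    divide : ∀ {n k x y} → Good n x → Good (n ℕ.+ k) y → 3 ^ᶻ n ∣ re (conj x ∙ y) →
      ∃[ z ] norm z ≡ 3 ^ᶻ k × ¬ + 2 ∣ un z × (1 ℕ.≤ k → ¬ + 3 ∣ re z) × + 2 ∣ det x z - det x y
    divide {n} {k} {x} {y} gx gy d
      with quotient {3 ^ᶻ n} {1ℤ} {3 ^ᶻ k} {{ℕ.m^n≢0 3 n}} x y
        (λ z → ^-cancel-∤ prime3 n ¬3∣v) (λ z → ^-cancel-∤ prime3 n (¬3∣re gx))
        (trans (norm≡ gx) (sym (*-identityʳ _)))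
        (trans (norm≡ gy) (trans (^ᶻ-+ 3 n k) (cong (3 ^ᶻ n *_) (sym (*-identityˡ _))))) d
    ... | z , eq , eq′ , nz = z , nz′ , un-quotient x y z eq (¬2∣un gx) (¬2∣un gy) , prim
        , ∣-resp (identity (ty x) (ty y) (ty z) (cl x) (cl y) (cl z))
           (∣m∣n⇒∣m+n
             (∣n⇒∣m*n (ty x) (cl-quotient x y z (∤-^ prime2 (from-no (+ 2 ∣? + 3)) n (s≤s (s≤s z≤n))) eq (¬2∣un gx) (¬2∣un gy)))
             (∣m⇒∣m*n (cl x) (subst (λ w → + 2 ∣ ty w - (ty x + ty z)) y≡ (ty-∙ x z))))
      where
      nz′ : norm z ≡ 3 ^ᶻ k
      nz′ = trans nz (*-identityˡ _)
      1⊙ : ∀ y → 1ℤ ⊙ y ≡ y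
      1⊙ (E a b) = cong₂ E (*-identityˡ a) (*-identityˡ b)
      1⊙ (O a b) = cong₂ O (*-identityˡ a) (*-identityˡ b)
      y≡ : x ∙ z ≡ y
      y≡ = trans eq′ (1⊙ y)
      -- When 3 divides the norm of `z`, a factor 3 of `re z` divides all of `z`, hence also `y`,
      -- which is `x ∙ z`.
      prim : 1 ℕ.≤ k → ¬ + 3 ∣ re z
      prim (s≤s {n = k′} _) d₁ with ⊙-quotient z d₁ (∣im prime3 ¬3∣v ¬3∣e z (∣-resp (sym (trans nz′ (^ᶻ-suc 3 k′))) (∣m⇒∣m*n (3 ^ᶻ k′) ∣-refl)) d₁)
      ... | w , refl = ¬3∣re gy (∣-resp (trans (sym (re-⊙ (+ 3) (x ∙ w))) (cong re (trans (sym (∙-⊙ (+ 3) x w)) y≡))) (∣m⇒∣m*n (re (x ∙ w)) ∣-refl))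
      identity : ∀ tx ty tz cx cy cz → tx * (cz - (cy - cx)) + (ty - (tx + tz)) * cx ≡ (tx * cz - tz * cx) - (tx * cy - ty * cx)
      identity = solve-∀

    -- Conjugation only negates the class, and signs are invisible modulo 2.
    det-conj : ∀ x y → + 2 ∣ det (conj x) y - det x y
    det-conj x y rewrite ty-conj x | cl-conj x = divides (ty y * cl x) (identity (ty x) (ty y) (cl x) (cl y))
      where
      identity : ∀ tx ty cx cy → (tx * cy - ty * - cx) - (tx * cy - ty * cx) ≡ ty * cx * + 2
      identity = solve-∀

    det-swap : ∀ x y → det x y ≡ - det y x
    det-swap x y = identity (ty x) (ty y) (cl x) (cl y)
      where
      identity : ∀ tx ty cx cy → tx * cy - ty * cx ≡ - (ty * cx - tx * cy)
      identity = solve-∀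

    det-norm1 : ∀ x z → ¬ + 2 ∣ un z → norm z ≡ 1ℤ → det x z ≡ 0ℤ
    det-norm1 x z uz nz with norm1 z uz nz
    ... | tz , cz = trans (cong₂ (λ a b → ty x * a - b * cl x) cz tz) (identity (ty x) (cl x))
      where
      identity : ∀ a b → a * 0ℤ - 0ℤ * b ≡ 0ℤ
      identity = solve-∀

    ∣-minus : ∀ {a b} → + 2 ∣ a - b → + 2 ∣ a → + 2 ∣ b
    ∣-minus {a} {b} d d′ = ∣-resp (identity a b) (∣m∣n⇒∣m-n d′ d)
      where
      identity : ∀ a b → a - (a - b) ≡ b
      identity = solve-∀

    -- Euclid's algorithm on the exponents of the norms: each division subtracts the smaller
    -- exponent from the larger and keeps the determinant modulo 2, until a quotient of norm 1 gives
    -- determinant 0. Exponents stay positive, whence the `suc`s; `fuel` exceeds the sum of their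
    -- predecessors.
    descent : ∀ fuel {n m x y} → n ℕ.+ m ℕ.< fuel → Good (suc n) x → Good (suc m) y → + 2 ∣ det x y
    descent-≤ : ∀ fuel {n k x y} → n ℕ.+ (n ℕ.+ k) ℕ.< fuel → Good (suc n) x → Good (suc n ℕ.+ k) y → + 2 ∣ det x y
    descent-∣ : ∀ fuel {n k x y} → n ℕ.+ (n ℕ.+ k) ℕ.< fuel → Good (suc n) x → Good (suc n ℕ.+ k) y → 3 ^ᶻ suc n ∣ re (conj x ∙ y) → + 2 ∣ det x y

    descent fuel {n} {m} {x} {y} le gx gy with ℕ.≤-total n m
    ... | inj₁ n≤m with ℕ.m≤n⇒∃[o]m+o≡n n≤m
    ...   | k , refl = descent-≤ fuel le gx gy
    descent fuel {n} {m} {x} {y} le gx gy | inj₂ m≤n with ℕ.m≤n⇒∃[o]m+o≡n m≤n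
    ...   | k , refl = ∣-resp (sym (det-swap x y)) (∣m⇒∣-m
            (descent-≤ fuel (subst (ℕ._< fuel) (ℕ.+-comm (m ℕ.+ k) m) le) gy gx))

    descent-≤ fuel {x = x} {y} lt gx gy with split gx gy
    ... | inj₁ d = descent-∣ fuel lt gx gy d
    ... | inj₂ d = ∣-minus {det (conj x) y} (det-conj x y)
          (descent-∣ fuel lt (Good-conj gx) gy (subst (λ w → _ ∣ re (w ∙ y)) (sym (conj-conj x)) d))

    descent-∣ (suc fuel) {n} {k} {x} {y} (s≤s lt) gx gy d = continue k refl (divide gx gy d)
      where
      continue : ∀ k′ → k ≡ k′ → (∃[ z ] norm z ≡ 3 ^ᶻ k × ¬ + 2 ∣ un z × (1 ℕ.≤ k → ¬ + 3 ∣ re z) × + 2 ∣ det x z - det x y) → + 2 ∣ det x y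
      continue zero refl (z , nz , uz , _ , dz) = ∣-minus dz (divides 0ℤ (det-norm1 x z uz nz))
      continue (suc k′) refl (z , nz , uz , pz , dz) = ∣-minus dz
        (descent fuel {y = z} (ℕ.<-≤-trans (ℕ.+-monoʳ-< n (ℕ.m≤n+m (suc k′) n)) lt) gx (good nz (pz (s≤s z≤n)) uz))

  -- Elements whose norm is a power of 2.

  odd-odd : ∀ {a b} → ¬ + 2 ∣ a → ¬ + 2 ∣ b → + 2 ∣ a - b
  odd-odd {a} {b} na nb with mod2 a | mod2 b
  ... | r0 c eq | _ = contradiction (divides c eq) na
  ... | _ | r0 c eq = contradiction (divides c eq) nb
  ... | r1 c refl | r1 d refl = divides (c - d) (identity c d)
    where
    identity : ∀ c d → (1ℤ + c * + 2) - (1ℤ + d * + 2) ≡ (c - d) * + 2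
    identity = solve-∀

  module NormPowerOf2 (v₀ e₀ : ℕ) (1≤v : 1 ℕ.≤ v₀) (5≤e : 5 ℕ.≤ e₀)
      (3∣v : + 3 ∣ + v₀) (¬3∣e : ¬ + 3 ∣ + e₀) (¬2∣v : ¬ + 2 ∣ + v₀) (¬2∣e : ¬ + 2 ∣ + e₀) where
    v e : ℤ
    v = + v₀
    e = + e₀
    open Quadratic v e
    open Classes v e prime3 3∣v ¬3∣e square≡1-mod3

    -- To avoid half-integers, an `x` with odd coordinates stands for x/2, whose norm is `2 ^ n`.
    -- This explains the shift by 2 in the exponent, and why a product relation takes the form
    -- `x ∙ z ≡ + 2 ⊙ y`.
    record Good (n : ℕ) (x : El) : Set where
      constructor good
      field
        norm≡ : norm x ≡ 2 ^ᶻ (2 ℕ.+ n)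
        ¬2∣re : ¬ + 2 ∣ re x
        ¬2∣im : ¬ + 2 ∣ im x
        ¬3∣un : ¬ + 3 ∣ un x
    open Good

    ∣-neg : ∀ {k a} → k ∣ - a → k ∣ a
    ∣-neg {k} {a} d = ∣-resp (identity a) (∣m⇒∣-m d)
      where
      identity : ∀ a → - - a ≡ a
      identity = solve-∀

    im-conj : ∀ x → im (conj x) ≡ - im x
    im-conj (E _ _) = refl
    im-conj (O _ _) = refl

    Good-conj : ∀ {n x} → Good n x → Good n (conj x)
    Good-conj {x = x} (good a b c u) = good (trans (norm-conj x) a)
      (λ d → b (∣-resp (re-conj x) d)) (λ d → c (∣-neg (∣-resp (im-conj x) d))) (un-conj x u)

    -- These are the doubled units: as `e₀` is at least 5, a norm of 4 forces `t` to vanish, and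
    -- then kind `E` is excluded because `un` is prime to 3.
    norm4 : ∀ x → ¬ + 3 ∣ un x → norm x ≡ + 4 → x ≡ O (+ 2) 0ℤ ⊎ x ≡ O (- (+ 2)) 0ℤ
    norm4 (E s t) u eq with abs t in teq | trans (sym (norm-E v₀ e₀ s t)) eq
    ... | zero | _ = contradiction (divides 0ℤ (∣i∣≡0⇒i≡0 teq)) u
    ... | suc b | eq′ = ⊥-elim (ℕ.<-irrefl (sym (+-injective eq′))
          (ℕ.≤-trans 5≤e (ℕ.≤-trans (ℕ.m≤m*n e₀ _) (ℕ.m≤n+m _ _))))
    norm4 (O s t) u eq with abs t in teq | trans (sym (norm-O v₀ e₀ s t)) eq
    ... | suc b | eq′ = ⊥-elim (ℕ.<-irrefl (sym (+-injective eq′))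
          (ℕ.≤-trans (ℕ.*-mono-≤ 1≤v 5≤e) (ℕ.≤-trans (ℕ.m≤m*n (v₀ ℕ.* e₀) _) (ℕ.m≤n+m _ _))))
    ... | zero | eq′ rewrite ∣i∣≡0⇒i≡0 {t} teq | ℕ.*-zeroʳ (v₀ ℕ.* e₀) | ℕ.+-identityʳ (abs s ℕ.* abs s) = sqrt4 s (+-injective eq′)
      where
      sqrt4 : ∀ s → abs s ℕ.* abs s ≡ 4 → O s 0ℤ ≡ O (+ 2) 0ℤ ⊎ O s 0ℤ ≡ O (- (+ 2)) 0ℤ
      sqrt4 (+ 2) _ = inj₁ refl
      sqrt4 -[1+ 1 ] _ = inj₂ refl
      sqrt4 (+ suc (suc (suc n))) q = contradiction q (λ q → ℕ.<-irrefl (sym q) (ℕ.≤-trans (ℕ.m≤m+n 5 4) (ℕ.*-mono-≤ {3} {suc (suc (suc n))} {3} (s≤s (s≤s (s≤s z≤n))) (s≤s (s≤s (s≤s z≤n))))))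
      sqrt4 -[1+ suc (suc n) ] q = contradiction q (λ q → ℕ.<-irrefl (sym q) (ℕ.≤-trans (ℕ.m≤m+n 5 4) (ℕ.*-mono-≤ {3} {suc (suc (suc n))} {3} (s≤s (s≤s (s≤s z≤n))) (s≤s (s≤s (s≤s z≤n))))))

    re-∙-even : ∀ x y → ¬ + 2 ∣ re x → ¬ + 2 ∣ im x → ¬ + 2 ∣ re y → ¬ + 2 ∣ im y → + 2 ∣ re (x ∙ y)
    re-∙-even (E _ _) (E _ _) a b c d = odd-odd (∤-* prime2 ¬2∣v (∤-* prime2 a c)) (∤-* prime2 ¬2∣e (∤-* prime2 b d))
    re-∙-even (E _ _) (O _ _) a b c d = odd-odd (∤-* prime2 a c) (∤-* prime2 ¬2∣e (∤-* prime2 b d))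
    re-∙-even (O _ _) (E _ _) a b c d = odd-odd (∤-* prime2 a c) (∤-* prime2 ¬2∣e (∤-* prime2 b d))
    re-∙-even (O _ _) (O _ _) a b c d = odd-odd (∤-* prime2 a c) (∤-* prime2 (∤-* prime2 ¬2∣v ¬2∣e) (∤-* prime2 b d))

    ¬2∣re-factor : ∀ x y → ¬ + 2 ∣ re-factor x y
    ¬2∣re-factor (E _ _) (E _ _) = ¬2∣v
    ¬2∣re-factor (E _ _) (O _ _) = from-no (+ 2 ∣? 1ℤ)
    ¬2∣re-factor (O _ _) (E _ _) = from-no (+ 2 ∣? 1ℤ)
    ¬2∣re-factor (O _ _) (O _ _) = from-no (+ 2 ∣? 1ℤ)

    -- Halving both numbers costs two factors 2 of the product and makes the sum equal to the odd
    -- `z`, so `^-split` applies; doubling back returns one factor 2.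
    halve-split : ∀ n {x y z} → + 2 ∣ x → + 2 ∣ y → x + y ≡ + 2 * z → ¬ + 2 ∣ z → 2 ^ᶻ (2 ℕ.+ n) ∣ x * y →
      2 ^ᶻ suc n ∣ x ⊎ 2 ^ᶻ suc n ∣ y
    halve-split n {z = z} (divides a refl) (divides b refl) eq nz d = Sum.map (up a) (up b) (^-split prime2 n
        (λ d′ → nz (∣-resp (*-cancelˡ-≡ (+ 2) _ _ (trans (id₁ a b) eq)) d′))
        (*-cancelˡ-∣ (+ 4) (subst₂ _∣_ four (id₂ a b) d)))
      where
      up : ∀ a → 2 ^ᶻ n ∣ a → 2 ^ᶻ suc n ∣ a * + 2
      up a d = subst₂ _∣_ (sym (^ᶻ-suc 2 n)) (*-comm (+ 2) a) (*-monoʳ-∣ (+ 2) d)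
      id₁ : ∀ a b → + 2 * (a + b) ≡ a * + 2 + b * + 2
      id₁ = solve-∀
      id₂ : ∀ a b → a * + 2 * (b * + 2) ≡ + 4 * (a * b)
      id₂ = solve-∀
      four : 2 ^ᶻ (2 ℕ.+ n) ≡ + 4 * 2 ^ᶻ n
      four = ^ᶻ-+ 2 2 n

    split : ∀ {n k x y} → Good n x → Good (n ℕ.+ k) y → 2 ^ᶻ suc n ∣ re (conj x ∙ y) ⊎ 2 ^ᶻ suc n ∣ re (x ∙ y)
    split {n} {k} {x} {y} gx gy = halve-split n
      (re-∙-even (conj x) y (¬2∣re gx̄) (¬2∣im gx̄) (¬2∣re gy) (¬2∣im gy))
      (re-∙-even x y (¬2∣re gx) (¬2∣im gx) (¬2∣re gy) (¬2∣im gy))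
      (re-sum x y)
      (∤-* prime2 (¬2∣re-factor x y) (∤-* prime2 (¬2∣re gx) (¬2∣re gy)))
      (re-product x y (∣-resp (sym (norm≡ gx)) ∣-refl)
        (∣-resp (trans (sym (^ᶻ-+ 2 (2 ℕ.+ n) k)) (sym (norm≡ gy))) (∣m⇒∣m*n (2 ^ᶻ k) ∣-refl)))
      where
      gx̄ : Good n (conj x)
      gx̄ = Good-conj gx

    -- An even norm gives the coordinates of `y` equal parity: either both are odd, which is
    -- `re-∙-even`, or a factor 2 can be taken out of `y`.
    re-∙-even-norm : ∀ x y → ¬ + 2 ∣ re x → ¬ + 2 ∣ im x → + 2 ∣ norm y → + 2 ∣ re (x ∙ y)
    re-∙-even-norm x y a b dn with + 2 ∣? re y
    ... | no nr = re-∙-even x y a b nr (λ d → nr (∣re prime2 ¬2∣v ¬2∣e y dn d))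
    ... | yes dr with ⊙-quotient y dr (∣im prime2 ¬2∣v ¬2∣e y dn dr)
    ...   | w , refl = ∣-resp (trans (sym (re-⊙ (+ 2) (x ∙ w))) (cong re (sym (∙-⊙ (+ 2) x w)))) (∣m⇒∣m*n (re (x ∙ w)) ∣-refl)

    -- If `z` were twice some `w`, then `y` would be `x ∙ w` with `norm w` still even, and `re y`
    -- would be even.
    quotient-odd : ∀ {n m k x y z} → Good n x → Good m y → x ∙ z ≡ + 2 ⊙ y → norm z ≡ 2 ^ᶻ (3 ℕ.+ k) →
      ¬ (+ 2 ∣ re z × + 2 ∣ im z)
    quotient-odd {k = k} {x} {y} {z} gx gy eq nz (dr , di) with ⊙-quotient z dr di
    ... | w , refl = ¬2∣re gy (∣-resp (cong re (⊙-cancel (+ 2) (trans (sym (∙-⊙ (+ 2) x w)) eq)))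
        (re-∙-even-norm x w (¬2∣re gx) (¬2∣im gx) (∣-resp (sym nw) (∣m⇒∣m*n (2 ^ᶻ k) ∣-refl))))
      where
      nw : norm w ≡ + 2 * 2 ^ᶻ k
      nw = *-cancelˡ-≡ (+ 4) _ _ (trans (sym (norm-⊙ (+ 2) w)) (trans nz (trans (^ᶻ-+ 2 2 (suc k)) (cong (+ 4 *_) (^ᶻ-suc 2 k)))))

    divide : ∀ {n k x y} → Good n x → Good (n ℕ.+ k) y → 2 ^ᶻ suc n ∣ re (conj x ∙ y) →
      ∃[ z ] x ∙ z ≡ + 2 ⊙ y × norm z ≡ 2 ^ᶻ (2 ℕ.+ k) × ¬ + 3 ∣ un z × + 3 ∣ cl z - (cl y - cl x)
    divide {n} {k} {x} {y} gx gy d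
      with quotient {2 ^ᶻ suc n} {+ 2} {2 ^ᶻ k} {{ℕ.m^n≢0 2 (suc n)}} x y
        (λ z → ^-cancel-∤ prime2 (suc n) ¬2∣v) (λ z → ^-cancel-∤ prime2 (suc n) (¬2∣re gx))
        (trans (norm≡ gx) (trans (^ᶻ-suc 2 (suc n)) (*-comm (+ 2) (2 ^ᶻ suc n))))
        (trans (norm≡ gy) (trans (^ᶻ-suc 2 (suc n ℕ.+ k)) (trans (cong (+ 2 *_) (^ᶻ-+ 2 (suc n) k)) (identity (2 ^ᶻ suc n) (2 ^ᶻ k))))) d
      where
      identity : ∀ a b → + 2 * (a * b) ≡ a * (+ 2 * b)
      identity = solve-∀
    ... | z , eq , eq′ , nz = z , eq′ , trans nz (sym (^ᶻ-+ 2 2 k)) , un-quotient x y z eq (¬3∣un gx) (¬3∣un gy)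
        , cl-quotient x y z (∤-^ prime3 (from-no (+ 3 ∣? + 2)) (suc n) (s≤s (s≤s z≤n))) eq (¬3∣un gx) (¬3∣un gy)

    cube : El → El
    cube x = x ∙ x ∙ x

    -- Powers of 2 are disregarded because a conjugate is an inverse only up to the norm, which is a
    -- power of 2. Signs need no such treatment, since -1 is a cube.
    IsCube : El → Set
    IsCube x = ∃[ f ] ∃[ d ] 2 ^ᶻ f ⊙ x ≡ cube d

    ⊙-∙ : ∀ k x y → (k ⊙ x) ∙ y ≡ k ⊙ (x ∙ y)
    ⊙-∙ k x y = trans (∙-comm (k ⊙ x) y) (trans (∙-⊙ k y x) (cong (k ⊙_) (∙-comm y x)))

    cube-⊙ : ∀ k x → cube (k ⊙ x) ≡ (k * k * k) ⊙ cube x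
    cube-⊙ k x = begin
      (k ⊙ x) ∙ (k ⊙ x) ∙ (k ⊙ x)  ≡⟨ ∙-⊙ k _ x ⟩
      k ⊙ ((k ⊙ x) ∙ (k ⊙ x) ∙ x)  ≡⟨ cong (λ w → k ⊙ (w ∙ x)) (trans (∙-⊙ k _ x) (cong (k ⊙_) (⊙-∙ k x x))) ⟩
      k ⊙ ((k ⊙ k ⊙ (x ∙ x)) ∙ x)  ≡⟨ cong (k ⊙_) (trans (cong (_∙ x) (⊙-⊙ k k _)) (⊙-∙ (k * k) (x ∙ x) x)) ⟩
      k ⊙ (k * k) ⊙ cube x         ≡⟨ ⊙-⊙ k (k * k) _ ⟩
      (k * (k * k)) ⊙ cube x       ≡⟨ cong (_⊙ cube x) (*-assoc k k k) ⟨
      (k * k * k) ⊙ cube x         ∎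
      where open ≡-Reasoning

    swap-middle : ∀ a b c d → a ∙ b ∙ (c ∙ d) ≡ a ∙ c ∙ (b ∙ d)
    swap-middle a b c d = begin
      a ∙ b ∙ (c ∙ d)    ≡⟨ ∙-assoc a b (c ∙ d) ⟩
      a ∙ (b ∙ (c ∙ d))  ≡⟨ cong (a ∙_) (∙-assoc b c d) ⟨
      a ∙ (b ∙ c ∙ d)    ≡⟨ cong (λ w → a ∙ (w ∙ d)) (∙-comm b c) ⟩
      a ∙ (c ∙ b ∙ d)    ≡⟨ cong (a ∙_) (∙-assoc c b d) ⟩
      a ∙ (c ∙ (b ∙ d))  ≡⟨ ∙-assoc a c (b ∙ d) ⟨
      a ∙ c ∙ (b ∙ d)    ∎
      where open ≡-Reasoning

    cube-∙ : ∀ x y → cube (x ∙ y) ≡ cube x ∙ cube y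
    cube-∙ x y = trans (cong (_∙ (x ∙ y)) (swap-middle x y x y)) (swap-middle (x ∙ x) (y ∙ y) x y)

    cube-conj : ∀ x → cube (conj x) ≡ conj (cube x)
    cube-conj x = sym (trans (conj-∙ (x ∙ x) x) (cong (_∙ conj x) (conj-∙ x x)))

    IsCube-conj : ∀ {x} → IsCube x → IsCube (conj x)
    IsCube-conj {x} (f , d , eq) = f , conj d ,
      trans (sym (conj-⊙ (2 ^ᶻ f) x)) (trans (cong conj eq) (sym (cube-conj d)))

    IsCube-2^⁻ : ∀ j {x} → IsCube (2 ^ᶻ j ⊙ x) → IsCube x
    IsCube-2^⁻ j {x} (f , d , eq) = f ℕ.+ j , d ,
      trans (trans (cong (_⊙ x) (^ᶻ-+ 2 f j)) (sym (⊙-⊙ (2 ^ᶻ f) (2 ^ᶻ j) x))) eq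

    -- Two further copies of `2 ^ᶻ j`, hidden in the disregarded power, complete it to a cube.
    IsCube-2^ : ∀ j {x} → IsCube x → IsCube (2 ^ᶻ j ⊙ x)
    IsCube-2^ j {x} (f , d , eq) = f ℕ.+ (j ℕ.+ j) , 2 ^ᶻ j ⊙ d , (begin
      2 ^ᶻ (f ℕ.+ (j ℕ.+ j)) ⊙ 2 ^ᶻ j ⊙ x  ≡⟨ ⊙-⊙ _ _ x ⟩
      (2 ^ᶻ (f ℕ.+ (j ℕ.+ j)) * k) ⊙ x     ≡⟨ cong (λ w → (w * k) ⊙ x) (trans (^ᶻ-+ 2 f (j ℕ.+ j)) (cong (2 ^ᶻ f *_) (^ᶻ-+ 2 j j))) ⟩
      (2 ^ᶻ f * (k * k) * k) ⊙ x           ≡⟨ cong (_⊙ x) (identity (2 ^ᶻ f) k) ⟩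
      (k * k * k * 2 ^ᶻ f) ⊙ x             ≡⟨ ⊙-⊙ (k * k * k) (2 ^ᶻ f) x ⟨
      (k * k * k) ⊙ 2 ^ᶻ f ⊙ x             ≡⟨ cong ((k * k * k) ⊙_) eq ⟩
      (k * k * k) ⊙ cube d                 ≡⟨ cube-⊙ k d ⟨
      cube (k ⊙ d)                         ∎)
      where
      open ≡-Reasoning
      k : ℤ
      k = 2 ^ᶻ j
      identity : ∀ f k → f * (k * k) * k ≡ k * k * k * f
      identity = solve-∀

    IsCube-cube∙ : ∀ x {y} → IsCube y → IsCube (cube x ∙ y)
    IsCube-cube∙ x {y} (f , d , eq) = f , x ∙ d ,
      trans (sym (∙-⊙ (2 ^ᶻ f) (cube x) y)) (trans (cong (cube x ∙_) eq) (sym (cube-∙ x d)))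

    -- x^(cl y) y^(−cl x) is a cube up to powers of 2, spelled out for the four points
    -- (cl x : cl y) of the projective line over 𝔽₃; conjugation plays the role of inversion.
    record CubeRelation (x y : El) : Set where
      constructor cube-relation
      field
        right  : + 3 ∣ cl y → ¬ + 3 ∣ cl x → IsCube y
        left   : + 3 ∣ cl x → ¬ + 3 ∣ cl y → IsCube x
        minus  : ¬ + 3 ∣ cl x → + 3 ∣ cl x - cl y → IsCube (conj x ∙ y)
        plus   : ¬ + 3 ∣ cl x → + 3 ∣ cl x + cl y → IsCube (x ∙ y)
    open CubeRelation

    CubeRelation-swap : ∀ {x y} → CubeRelation x y → CubeRelation y x
    CubeRelation-swap {x} {y} c = cube-relation (left c) (right c)
      (λ ny d → subst IsCube (trans (conj-∙ (conj x) y) (trans (cong (_∙ conj y) (conj-conj x)) (∙-comm x (conj y))))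
        (IsCube-conj (minus c (λ dx → ny (∣-resp (id₁ (cl x) (cl y)) (∣m∣n⇒∣m+n d dx))) (∣-resp (id₂ (cl x) (cl y)) (∣m⇒∣-m d)))))
      (λ ny d → subst IsCube (∙-comm x y) (plus c (λ dx → ny (∣-resp (id₃ (cl x) (cl y)) (∣m∣n⇒∣m-n d dx))) (∣-resp (id₄ (cl x) (cl y)) d)))
      where
      id₁ : ∀ x y → (y - x) + x ≡ y
      id₁ = solve-∀
      id₂ : ∀ x y → - (y - x) ≡ x - y
      id₂ = solve-∀
      id₃ : ∀ x y → (y + x) - x ≡ y
      id₃ = solve-∀
      id₄ : ∀ x y → y + x ≡ x + y
      id₄ = solve-∀

    CubeRelation-conj : ∀ {x y} → CubeRelation (conj x) y → CubeRelation x y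
    CubeRelation-conj {x} {y} c = cube-relation
      (λ dy nx → right c dy (neg nx))
      (λ dx ny → subst IsCube (conj-conj x) (IsCube-conj (left c (∣-resp (sym (cl-conj x)) (∣m⇒∣-m dx)) ny)))
      (λ nx d → plus c (neg nx) (∣-resp (trans (id₁ (cl x) (cl y)) (cong (_+ cl y) (sym (cl-conj x)))) (∣m⇒∣-m d)))
      (λ nx d → subst (λ w → IsCube (w ∙ y)) (conj-conj x)
        (minus c (neg nx) (∣-resp (trans (id₂ (cl x) (cl y)) (cong (_- cl y) (sym (cl-conj x)))) (∣m⇒∣-m d))))
      where
      neg : ¬ + 3 ∣ cl x → ¬ + 3 ∣ cl (conj x)
      neg nx d = nx (∣-neg (∣-resp (cl-conj x) d))
      id₁ : ∀ x y → - (x - y) ≡ - x + y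
      id₁ = solve-∀
      id₂ : ∀ x y → - (x + y) ≡ - x - y
      id₂ = solve-∀

    -- Here `z` is ±2 and has class 0, so `left`, `minus` and `plus` are vacuous; for `right`, 4 ·
    -- (±2) = (±2)³.
    CubeRelation-norm4 : ∀ x z → ¬ + 3 ∣ un z → norm z ≡ + 4 → CubeRelation x z
    CubeRelation-norm4 x z u nz = cube-relation (λ _ _ → cb z (norm4 z u nz)) (λ _ n → contradiction (3∣cl z (norm4 z u nz)) n)
      (λ nx d → contradiction (∣-resp (id₁ (cl x) (cl z)) (∣m∣n⇒∣m+n d (3∣cl z (norm4 z u nz)))) nx)
      (λ nx d → contradiction (∣-resp (id₂ (cl x) (cl z)) (∣m∣n⇒∣m-n d (3∣cl z (norm4 z u nz)))) nx)
      where
      zero-cl : ∀ e s → - (e * (s * 0ℤ)) ≡ 0ℤ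
      zero-cl = solve-∀
      3∣cl : ∀ z → z ≡ O (+ 2) 0ℤ ⊎ z ≡ O (- (+ 2)) 0ℤ → + 3 ∣ cl z
      3∣cl _ (inj₁ refl) = divides 0ℤ (zero-cl e (+ 2))
      3∣cl _ (inj₂ refl) = divides 0ℤ (zero-cl e (- (+ 2)))
      cb : ∀ z → z ≡ O (+ 2) 0ℤ ⊎ z ≡ O (- (+ 2)) 0ℤ → IsCube z
      cb _ (inj₁ refl) = 2 , O (+ 2) 0ℤ , cong₂ O (q v e) (q′ v e)
        where
        q : ∀ v e → + 8 ≡ (+ 2 * + 2 - v * e * (0ℤ * 0ℤ)) * + 2 - v * e * ((+ 2 * 0ℤ + 0ℤ * + 2) * 0ℤ)
        q = solve-∀
        q′ : ∀ v e → 0ℤ ≡ (+ 2 * + 2 - v * e * (0ℤ * 0ℤ)) * 0ℤ + (+ 2 * 0ℤ + 0ℤ * + 2) * + 2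
        q′ = solve-∀
      cb _ (inj₂ refl) = 2 , O (- (+ 2)) 0ℤ , cong₂ O (q v e) (q′ v e)
        where
        q : ∀ v e → - (+ 8) ≡ (- (+ 2) * - (+ 2) - v * e * (0ℤ * 0ℤ)) * - (+ 2) - v * e * ((- (+ 2) * 0ℤ + 0ℤ * - (+ 2)) * 0ℤ)
        q = solve-∀
        q′ : ∀ v e → 0ℤ ≡ (- (+ 2) * - (+ 2) - v * e * (0ℤ * 0ℤ)) * 0ℤ + (- (+ 2) * 0ℤ + 0ℤ * - (+ 2)) * - (+ 2)
        q′ = solve-∀
      id₁ : ∀ x z → (x - z) + z ≡ x
      id₁ = solve-∀
      id₂ : ∀ x z → (x + z) - z ≡ x
      id₂ = solve-∀

    -- As the class of `z` is that of `y` minus that of `x`, each case for `x` and `y` reduces to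
    -- one for `x` and `z`. Up to powers of 2, `y` is `x ∙ z`, `conj x ∙ y` is `z`, and `x ∙ y` is
    -- `cube x ∙ (conj x ∙ z)`.
    CubeRelation-step : ∀ {j x y z} → norm x ≡ 2 ^ᶻ j → x ∙ z ≡ + 2 ⊙ y → + 3 ∣ cl z - (cl y - cl x) → CubeRelation x z → CubeRelation x y
    CubeRelation-step {j} {x} {y} {z} nx eq h c = cube-relation
      (λ dy n → IsCube-2^⁻ 1 (subst IsCube eq
        (plus c n (∣-resp (id₁ (cl x) (cl y) (cl z)) (∣m∣n⇒∣m+n h dy)))))
      (λ dx n → left c dx (λ dz → n (∣-resp (id₂ (cl x) (cl y) (cl z)) (∣m∣n⇒∣m+n (∣m∣n⇒∣m-n dz h) dx))))
      (λ n d → IsCube-2^⁻ 1 (subst IsCube minus-eq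
        (IsCube-2^ j (right c (∣-resp (id₃ (cl x) (cl y) (cl z)) (∣m∣n⇒∣m-n h d)) n))))
      -- Now `cl y` is `- cl x`, so `cl z` is -2 times `cl x`, which modulo 3 is `cl x` itself.
      (λ n d → IsCube-2^⁻ 1 (IsCube-2^⁻ j (subst IsCube plus-eq
        (IsCube-cube∙ x (minus c n (∣-resp (id₄ (cl x) (cl y) (cl z))
          (∣m∣n⇒∣m+n (∣m∣n⇒∣m-n (∣n⇒∣m*n (- 1ℤ) h) d) (∣m⇒∣m*n (cl x) ∣-refl))))))))
      where
      open ≡-Reasoning
      minus-eq : 2 ^ᶻ j ⊙ z ≡ + 2 ⊙ (conj x ∙ y)
      minus-eq = begin
        2 ^ᶻ j ⊙ z                   ≡⟨ cong (_⊙ z) (trans (norm-conj x) nx) ⟨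
        norm (conj x) ⊙ z            ≡⟨ x∙[conjx∙y]≡normx⊙y (conj x) z ⟨
        conj x ∙ (conj (conj x) ∙ z) ≡⟨ cong (λ w → conj x ∙ (w ∙ z)) (conj-conj x) ⟩
        conj x ∙ (x ∙ z)             ≡⟨ cong (conj x ∙_) eq ⟩
        conj x ∙ (+ 2 ⊙ y)           ≡⟨ ∙-⊙ (+ 2) (conj x) y ⟩
        + 2 ⊙ (conj x ∙ y)           ∎
      plus-eq : cube x ∙ (conj x ∙ z) ≡ 2 ^ᶻ j ⊙ + 2 ⊙ (x ∙ y)
      plus-eq = begin
        x ∙ x ∙ x ∙ (conj x ∙ z)     ≡⟨ ∙-assoc (x ∙ x) x _ ⟩
        x ∙ x ∙ (x ∙ (conj x ∙ z))   ≡⟨ cong (x ∙ x ∙_) (x∙[conjx∙y]≡normx⊙y x z) ⟩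
        x ∙ x ∙ (norm x ⊙ z)         ≡⟨ ∙-⊙ (norm x) (x ∙ x) z ⟩
        norm x ⊙ (x ∙ x ∙ z)         ≡⟨ cong₂ _⊙_ nx (∙-assoc x x z) ⟩
        2 ^ᶻ j ⊙ (x ∙ (x ∙ z))       ≡⟨ cong (λ w → 2 ^ᶻ j ⊙ (x ∙ w)) eq ⟩
        2 ^ᶻ j ⊙ (x ∙ (+ 2 ⊙ y))     ≡⟨ cong (2 ^ᶻ j ⊙_) (∙-⊙ (+ 2) x y) ⟩
        2 ^ᶻ j ⊙ + 2 ⊙ (x ∙ y)       ∎
      id₁ : ∀ x y z → (z - (y - x)) + y ≡ x + z
      id₁ = solve-∀
      id₂ : ∀ x y z → z - (z - (y - x)) + x ≡ y
      id₂ = solve-∀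
      id₃ : ∀ x y z → (z - (y - x)) - (x - y) ≡ z
      id₃ = solve-∀
      id₄ : ∀ x y z → - 1ℤ * (z - (y - x)) - (x + y) + + 3 * x ≡ x - z
      id₄ = solve-∀

    -- Euclid's algorithm on the exponents once more, carrying `CubeRelation` along and ending at a
    -- quotient of norm 4.
    descent : ∀ fuel {n m} x y → n ℕ.+ m ℕ.< fuel → Good (suc n) x → Good (suc m) y → CubeRelation x y
    descent-≤ : ∀ fuel {n k} x y → n ℕ.+ (n ℕ.+ k) ℕ.< fuel → Good (suc n) x → Good (suc n ℕ.+ k) y → CubeRelation x y
    descent-∣ : ∀ fuel {n k} x y → n ℕ.+ (n ℕ.+ k) ℕ.< fuel → Good (suc n) x → Good (suc n ℕ.+ k) y →
      2 ^ᶻ suc (suc n) ∣ re (conj x ∙ y) → CubeRelation x y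

    descent fuel {n} {m} x y le gx gy with ℕ.≤-total n m
    ... | inj₁ n≤m with ℕ.m≤n⇒∃[o]m+o≡n n≤m
    ...   | k , refl = descent-≤ fuel x y le gx gy
    descent fuel {n} {m} x y le gx gy | inj₂ m≤n with ℕ.m≤n⇒∃[o]m+o≡n m≤n
    ...   | k , refl = CubeRelation-swap (descent-≤ fuel y x (subst (ℕ._< fuel) (ℕ.+-comm (m ℕ.+ k) m) le) gy gx)

    descent-≤ fuel x y lt gx gy with split gx gy
    ... | inj₁ d = descent-∣ fuel x y lt gx gy d
    ... | inj₂ d = CubeRelation-conj
          (descent-∣ fuel (conj x) y lt (Good-conj gx) gy (subst (λ w → _ ∣ re (w ∙ y)) (sym (conj-conj x)) d))

    descent-∣ (suc fuel) {n} {k} x y (s≤s lt) gx gy d = continue k refl (divide gx gy d)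
      where
      continue : ∀ k′ → k ≡ k′ → (∃[ z ] x ∙ z ≡ + 2 ⊙ y × norm z ≡ 2 ^ᶻ (2 ℕ.+ k) × ¬ + 3 ∣ un z × + 3 ∣ cl z - (cl y - cl x)) → CubeRelation x y
      continue zero refl (z , eq , nz , uz , cz) = CubeRelation-step {3 ℕ.+ n} (norm≡ gx) eq cz (CubeRelation-norm4 x z uz nz)
      continue (suc k′) refl (z , eq , nz , uz , cz) = CubeRelation-step {3 ℕ.+ n} (norm≡ gx) eq cz
        (descent fuel x z (ℕ.<-≤-trans (ℕ.+-monoʳ-< n (ℕ.m≤n+m (suc k′) n)) lt) gx
          (good nz (λ dr → odd (dr , ∣im prime2 ¬2∣v ¬2∣e z 2∣nz dr)) (λ di → odd (∣re prime2 ¬2∣v ¬2∣e z 2∣nz di , di)) uz))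
        where
        odd : ¬ (+ 2 ∣ re z × + 2 ∣ im z)
        odd = quotient-odd {k = k′} {x} {y} {z} gx gy eq nz
        2∣nz : + 2 ∣ norm z
        2∣nz = ∣-resp (sym (trans nz (^ᶻ-suc 2 (suc (suc k′))))) (∣m⇒∣m*n (2 ^ᶻ suc (suc k′)) ∣-refl)

  -- The cube equation.

  abs≡1 : ∀ a → abs a ≡ 1 → a ≡ 1ℤ ⊎ a ≡ - 1ℤ
  abs≡1 (+ 1) refl = inj₁ refl
  abs≡1 -[1+ 0 ] refl = inj₂ refl

  coprime-divisor-is-unit : ∀ {p} → Prime p → ∀ n a b → ¬ + p ∣ a → a * b ≡ p ^ᶻ n → a ≡ 1ℤ ⊎ a ≡ - 1ℤ
  coprime-divisor-is-unit {p} pr n a b na eq with ^-cancel-∤ pr n na (∣-resp (sym eq) ∣-refl)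
  ... | divides q refl = abs≡1 a (ℕ.m*n≡1⇒m≡1 (abs a) (abs q) (trans (sym (abs-* a q)) (cong abs aq≡1)))
    where
    instance
      p≢0 = prime⇒nonZero pr
      pⁿ≢0 = ℕ.m^n≢0 p n
    identity : ∀ a q r → r * (a * q) ≡ a * (q * r)
    identity = solve-∀
    aq≡1 : a * q ≡ 1ℤ
    aq≡1 = *-cancelˡ-≡ (p ^ᶻ n) (a * q) 1ℤ (trans (identity a q (p ^ᶻ n)) (trans eq (sym (*-identityʳ _))))

  8∣odd²-1 : ∀ a → ¬ + 2 ∣ a → + 8 ∣ a * a - 1ℤ
  8∣odd²-1 a na with mod2 a
  ... | r0 b eq = contradiction (divides b eq) na
  ... | r1 b refl with mod2 b
  ...   | r0 c refl = divides (c + + 2 * (c * c)) (identity c)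
    where
    identity : ∀ c → (1ℤ + c * + 2 * + 2) * (1ℤ + c * + 2 * + 2) - 1ℤ ≡ (c + + 2 * (c * c)) * + 8
    identity = solve-∀
  ...   | r1 c refl = divides (1ℤ + + 3 * c + + 2 * (c * c)) (identity c)
    where
    identity : ∀ c → (1ℤ + (1ℤ + c * + 2) * + 2) * (1ℤ + (1ℤ + c * + 2) * + 2) - 1ℤ ≡ (1ℤ + + 3 * c + + 2 * (c * c)) * + 8
    identity = solve-∀

  ∤-+ : ∀ {k a b} → k ∣ a → ¬ k ∣ b → ¬ k ∣ a + b
  ∤-+ da nb d = nb (∣m+n∣m⇒∣n d da)

  ∤-neg : ∀ {k a} → ¬ k ∣ a → ¬ k ∣ - a
  ∤-neg {k} {a} na d = na (∣-resp (identity a) (∣m⇒∣-m d))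
    where
    identity : ∀ a → - - a ≡ a
    identity = solve-∀

  module CubeEquation (d e₀ r : ℕ) (¬2∣e : ¬ + 2 ∣ + e₀) (8∣v+e : + 8 ∣ 3 ^ᶻ suc d + + e₀) where
    v w e : ℤ
    v = 3 ^ᶻ suc d
    w = 3 ^ᶻ d
    e = + e₀

    ¬2∣w : ¬ + 2 ∣ w
    ¬2∣w = ∤-^ prime2 (from-no (+ 2 ∣? + 3)) d (s≤s (s≤s z≤n))

    ¬2∣v : ¬ + 2 ∣ v
    ¬2∣v = ∤-^ prime2 (from-no (+ 2 ∣? + 3)) (suc d) (s≤s (s≤s z≤n))

    Solution : Set
    Solution = d ≡ 0 × e₀ ≡ 5 × r ≡ 0 ⊎ d ≡ 0 × e₀ ≡ 13 × r ≡ 1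

    -- The cube of s√v + t√−e is s Y √v + t X √−e.
    X Y : ℤ → ℤ → ℤ
    X s t = + 3 * (v * (s * s)) - e * (t * t)
    Y s t = v * (s * s) - + 3 * (e * (t * t))

    3^r≡1 : ∀ r → 3 ℕ.^ r ≡ 1 → r ≡ 0
    3^r≡1 zero _ = refl
    3^r≡1 (suc r) eq = contradiction (ℕ.m*n≡1⇒m≡1 3 (3 ℕ.^ r) eq) λ ()

    unit-squared : ∀ {τ} → τ ≡ 1ℤ ⊎ τ ≡ - 1ℤ → τ * τ ≡ 1ℤ
    unit-squared (inj₁ refl) = refl
    unit-squared (inj₂ refl) = refl

    -- Twice `w * (s * s)` would be a difference of two units, so `w * (s * s)` would be 0 or ±1;
    -- but it is odd and a multiple of 3.
    unit-equation : ∀ s → + 3 ∣ w * (s * s) → ¬ + 2 ∣ s → ∀ {τ u} → τ ≡ 1ℤ ⊎ τ ≡ - 1ℤ → u ≡ 1ℤ ⊎ u ≡ - 1ℤ →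
      ¬ (τ - + 2 * (w * (s * s)) ≡ u)
    unit-equation s d3 ns {τ} {u} hτ hu eq = bad hτ hu
      where
      z = w * (s * s)
      two : + 2 * z ≡ τ - u
      two = trans (identity τ z) (cong (λ q → τ - q) eq)
        where
        identity : ∀ τ z → + 2 * z ≡ τ - (τ - + 2 * z)
        identity = solve-∀
      odd-z : ¬ + 2 ∣ z
      odd-z = ∤-* prime2 ¬2∣w (∤-* prime2 ns ns)
      bad : τ ≡ 1ℤ ⊎ τ ≡ - 1ℤ → u ≡ 1ℤ ⊎ u ≡ - 1ℤ → ⊥
      bad (inj₁ refl) (inj₁ refl) = odd-z (∣-resp (sym (*-cancelˡ-≡ (+ 2) z 0ℤ two)) (divides 0ℤ refl))
      bad (inj₁ refl) (inj₂ refl) = from-no (+ 3 ∣? 1ℤ) (∣-resp (*-cancelˡ-≡ (+ 2) z 1ℤ two) d3)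
      bad (inj₂ refl) (inj₁ refl) = from-no (+ 3 ∣? - 1ℤ) (∣-resp (*-cancelˡ-≡ (+ 2) z (- 1ℤ) two) d3)
      bad (inj₂ refl) (inj₂ refl) = odd-z (∣-resp (sym (*-cancelˡ-≡ (+ 2) z 0ℤ two)) (divides 0ℤ refl))

    -- If 3 divides `w * (s * s)`, the second factor on the left is prime to 3, hence a unit,
    -- contrary to `unit-equation`. Otherwise `d` is 0 and `s` is a unit, which leaves four sign
    -- patterns.
    final-equation : ∀ s τ → τ ≡ 1ℤ ⊎ τ ≡ - 1ℤ → ¬ + 2 ∣ s → e ≡ + 3 * (v * (s * s)) - + 4 * τ →
      s * (τ - + 2 * (w * (s * s))) ≡ 3 ^ᶻ r → Solution
    final-equation s τ hτ ns he eq with + 3 ∣? w * (s * s)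
    ... | yes d3 = contradiction refl (unit-equation s d3 ns hτ
          (coprime-divisor-is-unit prime3 r (τ - + 2 * (w * (s * s))) s
            (λ d′ → unit∤ hτ (∣m+n∣n⇒∣m d′ (∣m⇒∣-m (∣n⇒∣m*n (+ 2) d3))))
            (trans (*-comm _ s) eq)))
      where
      unit∤ : τ ≡ 1ℤ ⊎ τ ≡ - 1ℤ → ¬ + 3 ∣ τ
      unit∤ (inj₁ refl) = from-no (+ 3 ∣? 1ℤ)
      unit∤ (inj₂ refl) = from-no (+ 3 ∣? - 1ℤ)
    ... | no n3 = go d refl
      where
      s-unit : s ≡ 1ℤ ⊎ s ≡ - 1ℤ
      s-unit = coprime-divisor-is-unit prime3 r s _ (λ d3 → n3 (∣n⇒∣m*n w (∣n⇒∣m*n s d3))) eq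
      go : ∀ d′ → d ≡ d′ → Solution
      go (suc d′) refl = contradiction (∣m⇒∣m*n (s * s) (∣-resp (sym (^ᶻ-suc 3 d′)) (∣m⇒∣m*n (3 ^ᶻ d′) ∣-refl))) n3
      go zero refl = go′ s-unit hτ
        where
        go′ : s ≡ 1ℤ ⊎ s ≡ - 1ℤ → τ ≡ 1ℤ ⊎ τ ≡ - 1ℤ → Solution
        go′ (inj₁ refl) (inj₁ refl) = contradiction eq λ ()
        go′ (inj₁ refl) (inj₂ refl) = contradiction eq λ ()
        -- For `s` equal to -1 and `v` equal to 3, `e` is 9 - 4τ and `3 ^ r` is 2 - τ.
        go′ (inj₂ refl) (inj₁ refl) = inj₁ (refl , +-injective he , 3^r≡1 r (sym (+-injective eq)))
        go′ (inj₂ refl) (inj₂ refl) = inj₂ (refl , +-injective he , three r (sym (+-injective eq)))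
          where
          three : ∀ r → 3 ℕ.^ r ≡ 3 → r ≡ 1
          three (suc r) q = cong suc (3^r≡1 r (ℕ.*-cancelˡ-≡ (3 ℕ.^ r) 1 3 q))

    -- Odd squares are 1 modulo 8, so `v * (s * s) + e * (t * t)` is congruent to `v + e`, that is
    -- to 0. Consequently `X s t` is divisible by 4 and not by 8.
    X-mod8 : ∀ s t → ¬ + 2 ∣ s → ¬ + 2 ∣ t → + 8 ∣ X s t - + 4 * (v * (s * s))
    X-mod8 s t ns nt = ∣-resp (identity v e s t) (∣m⇒∣-m (∣m∣n⇒∣m+n (∣m∣n⇒∣m+n
        (∣n⇒∣m*n v (8∣odd²-1 s ns)) (∣n⇒∣m*n e (8∣odd²-1 t nt))) 8∣v+e))
      where
      identity : ∀ v e s t → - (v * (s * s - 1ℤ) + e * (t * t - 1ℤ) + (v + e)) ≡ + 3 * (v * (s * s)) - e * (t * t) - + 4 * (v * (s * s))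
      identity = solve-∀

    4∣X : ∀ s t → ¬ + 2 ∣ s → ¬ + 2 ∣ t → + 4 ∣ X s t
    4∣X s t ns nt = ∣-resp (identity (X s t) (+ 4 * (v * (s * s))))
        (∣m∣n⇒∣m+n (∣-trans (divides (+ 2) refl) (X-mod8 s t ns nt)) (∣m⇒∣m*n (v * (s * s)) ∣-refl))
      where
      identity : ∀ a b → a - b + b ≡ a
      identity = solve-∀

    ¬8∣X : ∀ s t → ¬ + 2 ∣ s → ¬ + 2 ∣ t → ¬ + 8 ∣ X s t
    ¬8∣X s t ns nt d8 = ∤-* prime2 ¬2∣v (∤-* prime2 ns ns) (*-cancelˡ-∣ (+ 4) (∣-resp (identity (X s t) (+ 4 * (v * (s * s)))) (∣m∣n⇒∣m-n d8 (X-mod8 s t ns nt))))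
      where
      identity : ∀ a b → a - (a - b) ≡ b
      identity = solve-∀

    -- An odd divisor `t` of a power of 2 is ±1, and exactly two factors 2 occur in `X s t`; this
    -- forces `f` to be 2.
    odd-case : ∀ f s t → ¬ + 2 ∣ s → ¬ + 2 ∣ t → t * X s t ≡ 2 ^ᶻ f → s * Y s t ≡ 2 ^ᶻ f * 3 ^ᶻ suc r → Solution
    odd-case f s t ns nt eqX eqY = go f refl
      where
      ht : t ≡ 1ℤ ⊎ t ≡ - 1ℤ
      ht = coprime-divisor-is-unit prime2 f t (X s t) nt eqX
      go : ∀ f′ → f ≡ f′ → Solution
      go 0 refl = contradiction (∣-resp eqX (∣n⇒∣m*n t (4∣X s t ns nt))) (from-no (+ 4 ∣? + 1))
      go 1 refl = contradiction (∣-resp eqX (∣n⇒∣m*n t (4∣X s t ns nt))) (from-no (+ 4 ∣? + 2))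
      -- After eliminating `e` and writing `v` as three times `w`, both sides of the second equation
      -- are multiples of 12.
      go 2 refl = final-equation s t ht ns he (*-cancelˡ-≡ (+ 12) _ _ (begin
          + 12 * (s * (t - + 2 * (w * (s * s))))                       ≡⟨ id₁ s t w ⟩
          s * (+ 3 * w * (s * s) - + 3 * (+ 3 * (+ 3 * w * (s * s)) - + 4 * t)) ≡⟨ cong₂ (λ a b → s * (a * (s * s) - + 3 * b)) (sym (^ᶻ-suc 3 d)) (trans (cong (λ a → + 3 * (a * (s * s)) - + 4 * t) (sym (^ᶻ-suc 3 d))) (trans (sym he) (sym ett))) ⟩
          s * Y s t                                                    ≡⟨ eqY ⟩
          + 4 * 3 ^ᶻ suc r                                             ≡⟨ cong (+ 4 *_) (^ᶻ-suc 3 r) ⟩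
          + 4 * (+ 3 * 3 ^ᶻ r)                                         ≡⟨ id₂ (3 ^ᶻ r) ⟩
          + 12 * 3 ^ᶻ r                                                ∎))
        where
        open ≡-Reasoning
        ett : e * (t * t) ≡ e
        ett = trans (cong (e *_) (unit-squared ht)) (*-identityʳ e)
        x≡ : X s t ≡ + 4 * t
        x≡ = begin
          X s t              ≡⟨ *-identityˡ _ ⟨
          1ℤ * X s t         ≡⟨ cong (_* X s t) (unit-squared ht) ⟨
          t * t * X s t      ≡⟨ *-assoc t t _ ⟩
          t * (t * X s t)    ≡⟨ cong (t *_) eqX ⟩
          t * + 4            ≡⟨ *-comm t (+ 4) ⟩
          + 4 * t            ∎
        he : e ≡ + 3 * (v * (s * s)) - + 4 * t
        he = begin
          e                                          ≡⟨ ett ⟨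
          e * (t * t)                                ≡⟨ id₃ (+ 3 * (v * (s * s))) (e * (t * t)) ⟩
          + 3 * (v * (s * s)) - X s t                ≡⟨ cong (λ a → + 3 * (v * (s * s)) - a) x≡ ⟩
          + 3 * (v * (s * s)) - + 4 * t              ∎
          where
          id₃ : ∀ a b → b ≡ a - (a - b)
          id₃ = solve-∀
        id₁ : ∀ s t w → + 12 * (s * (t - + 2 * (w * (s * s)))) ≡ s * (+ 3 * w * (s * s) - + 3 * (+ 3 * (+ 3 * w * (s * s)) - + 4 * t))
        id₁ = solve-∀
        id₂ : ∀ a → + 4 * (+ 3 * a) ≡ + 12 * a
        id₂ = solve-∀
      go (suc (suc (suc f′))) refl = ¬8∣X-contra (^-cancel-∤ prime2 3 nt (∣-resp (sym (trans eqX (^ᶻ-+ 2 3 f′))) (∣m⇒∣m*n (2 ^ᶻ f′) ∣-refl)))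
        where
        ¬8∣X-contra : + 8 ∣ X s t → Solution
        ¬8∣X-contra d8 = contradiction d8 (¬8∣X s t ns nt)

    -- Descent on `f`: a common factor 2 of `s` and `t` takes 8 out of both equations. If the
    -- parities differ, one of the two equations fails modulo 2.
    solve-cube : ∀ fuel f s t → f ℕ.< fuel → t * X s t ≡ 2 ^ᶻ f → s * Y s t ≡ 2 ^ᶻ f * 3 ^ᶻ suc r → Solution
    solve-cube (suc fuel) f s t (s≤s lt) eqX eqY with mod2 s | mod2 t
    ... | r1 a refl | r1 b refl = odd-case f s t (odd a) (odd b) eqX eqY
      where
      odd : ∀ a → ¬ + 2 ∣ 1ℤ + a * + 2
      odd a d = from-no (+ 2 ∣? 1ℤ) (∣m+n∣n⇒∣m d (∣n⇒∣m*n a ∣-refl))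
    ... | r0 a refl | r1 b refl = even-odd f refl
      where
      even-odd : ∀ f′ → f ≡ f′ → Solution
      even-odd zero refl = contradiction (∣-resp (trans eqY (*-identityˡ _)) (∣m⇒∣m*n (Y s t) (∣n⇒∣m*n a ∣-refl)))
        (∤-^ prime2 (from-no (+ 2 ∣? + 3)) (suc r) (s≤s (s≤s z≤n)))
      even-odd (suc f′) refl = contradiction (∣-resp (sym (trans eqX (^ᶻ-suc 2 f′))) (∣m⇒∣m*n (2 ^ᶻ f′) ∣-refl))
        (∤-* prime2 nt (∤-+ (∣n⇒∣m*n (+ 3) (∣n⇒∣m*n v (∣m⇒∣m*n s (∣n⇒∣m*n a ∣-refl)))) (∤-neg (∤-* prime2 ¬2∣e (∤-* prime2 nt nt)))))
        where
        nt : ¬ + 2 ∣ t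
        nt d = from-no (+ 2 ∣? 1ℤ) (∣m+n∣n⇒∣m d (∣n⇒∣m*n b ∣-refl))
    ... | r1 a refl | r0 b refl = odd-even f refl
      where
      odd-even : ∀ f′ → f ≡ f′ → Solution
      odd-even zero refl = contradiction (∣-resp eqX (∣m⇒∣m*n (X s t) (∣n⇒∣m*n b ∣-refl))) (from-no (+ 2 ∣? 1ℤ))
      odd-even (suc f′) refl = contradiction (∣-resp (sym (trans eqY (cong (_* 3 ^ᶻ suc r) (^ᶻ-suc 2 f′)))) (∣m⇒∣m*n (3 ^ᶻ suc r) (∣m⇒∣m*n (2 ^ᶻ f′) ∣-refl)))
        (∤-* prime2 ns λ d → ∤-* prime2 ¬2∣v (∤-* prime2 ns ns) (∣m+n∣n⇒∣m d (∣m⇒∣-m (∣n⇒∣m*n (+ 3) (∣n⇒∣m*n e (∣m⇒∣m*n t (∣n⇒∣m*n b ∣-refl)))))))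
        where
        ns : ¬ + 2 ∣ s
        ns d = from-no (+ 2 ∣? 1ℤ) (∣m+n∣n⇒∣m d (∣n⇒∣m*n a ∣-refl))
    ... | r0 a refl | r0 b refl = even-even f refl
      where
      tX : t * X s t ≡ + 8 * (b * X a b)
      tX = identity v e a b
        where
        identity : ∀ v e a b → b * + 2 * (+ 3 * (v * (a * + 2 * (a * + 2))) - e * (b * + 2 * (b * + 2))) ≡ + 8 * (b * (+ 3 * (v * (a * a)) - e * (b * b)))
        identity = solve-∀
      sY : s * Y s t ≡ + 8 * (a * Y a b)
      sY = identity v e a b
        where
        identity : ∀ v e a b → a * + 2 * (v * (a * + 2 * (a * + 2)) - + 3 * (e * (b * + 2 * (b * + 2)))) ≡ + 8 * (a * (v * (a * a) - + 3 * (e * (b * b))))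
        identity = solve-∀
      8∣2^f : + 8 ∣ 2 ^ᶻ f
      8∣2^f = ∣-resp (trans (sym tX) eqX) (∣m⇒∣m*n (b * X a b) ∣-refl)
      even-even : ∀ f′ → f ≡ f′ → Solution
      even-even 0 refl = contradiction 8∣2^f (from-no (+ 8 ∣? + 1))
      even-even 1 refl = contradiction 8∣2^f (from-no (+ 8 ∣? + 2))
      even-even 2 refl = contradiction 8∣2^f (from-no (+ 8 ∣? + 4))
      even-even (suc (suc (suc f′))) refl = solve-cube fuel f′ a b (ℕ.<-≤-trans (s≤s (ℕ.m≤n+m f′ 2)) lt)
        (*-cancelˡ-≡ (+ 8) _ _ (trans (sym tX) (trans eqX (^ᶻ-+ 2 3 f′))))
        (*-cancelˡ-≡ (+ 8) _ _ (trans (sym sY) (trans eqY (trans (cong (_* 3 ^ᶻ suc r) (^ᶻ-+ 2 3 f′)) (*-assoc (+ 8) (2 ^ᶻ f′) (3 ^ᶻ suc r))))))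

  -- The two cases of Pillai's equation.

  -- The right-hand sides are the norms of `E 1ℤ 1ℤ` and `E (2 ^ᶻ suc r) 1ℤ`. Both have degree 1,
  -- and their classes are odd and even, so their determinant is odd, against `descent`.
  3-difference-unique : ∀ C d b r e → 2 ℕ.≤ e → 3 ℕ.^ suc d ≡ 2 ℕ.^ suc C ℕ.+ e →
    ¬ (3 ℕ.^ suc b ≡ 2 ℕ.^ suc C ℕ.* (2 ℕ.^ suc r ℕ.* 2 ℕ.^ suc r) ℕ.+ e)
  3-difference-unique C d b r e 2≤e eq₁ eq₂ = contradiction
      (descent (suc (d ℕ.+ b)) {n = d} {b} {E 1ℤ 1ℤ} {E (2 ^ᶻ suc r) 1ℤ} ℕ.≤-refl
        (good (trans (norm-E v₀ e 1ℤ 1ℤ) (cong +_ (trans (cong₂ ℕ._+_ (ℕ.*-identityʳ v₀) (ℕ.*-identityʳ e)) (sym eq₁))))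
          (from-no (+ 3 ∣? 1ℤ)) (from-no (+ 2 ∣? 1ℤ)))
        (good (trans (norm-E v₀ e (2 ^ᶻ suc r) 1ℤ) (cong +_ (trans (cong (v₀ ℕ.* (2 ℕ.^ suc r ℕ.* 2 ℕ.^ suc r) ℕ.+_) (ℕ.*-identityʳ e)) (sym eq₂))))
          (∤-^ prime3 (from-no (+ 3 ∣? + 2)) (suc r) (s≤s (s≤s z≤n))) (from-no (+ 2 ∣? 1ℤ))))
      (λ d2 → from-no (+ 2 ∣? 1ℤ) (∣-resp (identity (2 ^ᶻ suc r))
        (∣m∣n⇒∣m-n (∣-resp (sym (^ᶻ-suc 2 r)) (∣m⇒∣m*n (2 ^ᶻ r) ∣-refl)) d2)))
    where
    v₀ : ℕ
    v₀ = 2 ℕ.^ suc C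
    identity : ∀ x → x - (1ℤ * (x * 1ℤ) - 1ℤ * (1ℤ * 1ℤ)) ≡ 1ℤ
    identity = solve-∀
    2∣v : + 2 ∣ 2 ^ᶻ suc C
    2∣v = ∣-resp (sym (^ᶻ-suc 2 C)) (∣m⇒∣m*n (2 ^ᶻ C) ∣-refl)
    open NormPowerOf3 v₀ e (ℕ.m^n>0 2 (suc C)) 2≤e 2∣v
      (λ d2 → ∤-^ prime2 (from-no (+ 2 ∣? + 3)) (suc d) (s≤s (s≤s z≤n)) (∣-resp (cong +_ (sym eq₁)) (∣m∣n⇒∣m+n 2∣v d2)))
      (∤-^ prime3 (from-no (+ 3 ∣? + 2)) (suc C) (s≤s (s≤s z≤n)))
      (λ d3 → ∤-^ prime3 (from-no (+ 3 ∣? + 2)) (suc C) (s≤s (s≤s z≤n))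
        (∣m+n∣n⇒∣m (∣-resp (cong +_ eq₁) (∣-resp (sym (^ᶻ-suc 3 d)) (∣m⇒∣m*n (3 ^ᶻ d) ∣-refl))) d3)) using (descent; good)
    open Quadratic (+ v₀) (+ e)

  -- Of the two elements with these norms the first has class 1 and the second a class divisible by
  -- 3, so `right` makes the second a cube up to a power of 2.
  2-difference-solutions : ∀ C A d r e → 5 ℕ.≤ e → 2 ℕ.^ (3 ℕ.+ C) ≡ 3 ℕ.^ suc d ℕ.+ e →
    2 ℕ.^ (3 ℕ.+ A) ≡ 3 ℕ.^ suc d ℕ.* (3 ℕ.^ suc r ℕ.* 3 ℕ.^ suc r) ℕ.+ e →
    d ≡ 0 × e ≡ 5 × r ≡ 0 ⊎ d ≡ 0 × e ≡ 13 × r ≡ 1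
  2-difference-solutions C A d r e 5≤e eq₁ eq₂ = finish (CubeRelation.right
      (descent (suc (C ℕ.+ A)) {C} {A} (E 1ℤ 1ℤ) (E (3 ^ᶻ suc r) 1ℤ) ℕ.≤-refl
        (good (trans (norm-E v₀ e 1ℤ 1ℤ) (cong +_ (trans (cong₂ ℕ._+_ (ℕ.*-identityʳ v₀) (ℕ.*-identityʳ e)) (sym eq₁))))
          (from-no (+ 2 ∣? 1ℤ)) (from-no (+ 2 ∣? 1ℤ)) (from-no (+ 3 ∣? 1ℤ)))
        (good (trans (norm-E v₀ e (3 ^ᶻ suc r) 1ℤ) (cong +_ (trans (cong (v₀ ℕ.* (3 ℕ.^ suc r ℕ.* 3 ℕ.^ suc r) ℕ.+_) (ℕ.*-identityʳ e)) (sym eq₂))))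
          (∤-^ prime2 (from-no (+ 2 ∣? + 3)) (suc r) (s≤s (s≤s z≤n))) (from-no (+ 2 ∣? 1ℤ)) (from-no (+ 3 ∣? 1ℤ))))
      (∣m⇒∣m*n 1ℤ (∣-resp (sym (^ᶻ-suc 3 r)) (∣m⇒∣m*n (3 ^ᶻ r) ∣-refl)))
      (from-no (+ 3 ∣? 1ℤ)))
    where
    v₀ : ℕ
    v₀ = 3 ℕ.^ suc d
    3∣v : + 3 ∣ 3 ^ᶻ suc d
    3∣v = ∣-resp (sym (^ᶻ-suc 3 d)) (∣m⇒∣m*n (3 ^ᶻ d) ∣-refl)
    8∣v+e : + 8 ∣ 3 ^ᶻ suc d + + e
    8∣v+e = ∣-resp (trans (sym (^ᶻ-+ 2 3 C)) (cong +_ eq₁)) (∣m⇒∣m*n (2 ^ᶻ C) ∣-refl)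
    ¬2∣v : ¬ + 2 ∣ 3 ^ᶻ suc d
    ¬2∣v = ∤-^ prime2 (from-no (+ 2 ∣? + 3)) (suc d) (s≤s (s≤s z≤n))
    ¬2∣e : ¬ + 2 ∣ + e
    ¬2∣e d2 = ¬2∣v (∣m+n∣n⇒∣m (∣-trans (divides (+ 4) refl) 8∣v+e) d2)
    ¬3∣e : ¬ + 3 ∣ + e
    ¬3∣e d3 = ∤-^ prime3 (from-no (+ 3 ∣? + 2)) (3 ℕ.+ C) (s≤s (s≤s z≤n)) (∣-resp (cong +_ (sym eq₁)) (∣m∣n⇒∣m+n 3∣v d3))
    open NormPowerOf2 v₀ e (ℕ.m^n>0 3 (suc d)) 5≤e 3∣v ¬3∣e ¬2∣v ¬2∣e using (descent; good; IsCube; module CubeRelation)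
    open Quadratic (+ v₀) (+ e)
    open CubeEquation d e r ¬2∣e 8∣v+e using (Solution; solve-cube)
    finish : IsCube (E (3 ^ᶻ suc r) 1ℤ) → Solution
    -- Cubing preserves the degree, so the cube root of an `E` cannot be an `O`.
    finish (f , O s t , ())
    finish (f , E s t , eq) = solve-cube (suc f) f s t ℕ.≤-refl
      (trans (id₁ (3 ^ᶻ suc d) (+ e) s t) (trans (sym (cong im eq)) (*-identityʳ _)))
      (trans (id₂ (3 ^ᶻ suc d) (+ e) s t) (sym (cong re eq)))
      where
      id₁ : ∀ v e s t → t * (+ 3 * (v * (s * s)) - e * (t * t)) ≡ (v * (s * s) - e * (t * t)) * t + v * ((s * t + t * s) * s)
      id₁ = solve-∀
      id₂ : ∀ v e s t → s * (v * (s * s) - + 3 * (e * (t * t))) ≡ (v * (s * s) - e * (t * t)) * s - e * ((s * t + t * s) * t)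
      id₂ = solve-∀

open TwoTermEquations using (prime2; prime3; 3-difference-unique; 2-difference-solutions)
open import Data.Nat using (_+_; _*_; _^_; _%_; _/_; _≤_; _<_; NonZero; >-nonZero; _≟_; _≤?_)
open import Data.Nat.Divisibility
open import Data.Nat.DivMod using (m≡m%n+[m/n]*n; m%n<n; %-distribˡ-+; %-distribˡ-*; m∣n⇒o%n%m≡o%m; [m+kn]%n≡m%n)
open import Data.Nat.Properties
open import Data.Nat.Tactic.RingSolver using (solve-∀)

-- Residues of powers.

^-% : ∀ a k M .{{_ : NonZero k}} .{{_ : NonZero M}} → a ^ k % M ≡ 1 % M → ∀ n → a ^ n % M ≡ a ^ (n % k) % M
^-% a k M h n = begin
  a ^ n % M                                  ≡⟨ cong (λ i → a ^ i % M) (m≡m%n+[m/n]*n n k) ⟩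
  a ^ (n % k + n / k * k) % M                ≡⟨ go (n / k) ⟩
  a ^ (n % k) % M                            ∎
  where
  open ≡-Reasoning
  go : ∀ q → a ^ (n % k + q * k) % M ≡ a ^ (n % k) % M
  go zero = cong (λ i → a ^ i % M) (+-identityʳ (n % k))
  go (suc q) = begin
    a ^ (n % k + (k + q * k)) % M                     ≡⟨ cong (λ i → a ^ i % M) (rearrange (n % k) k (q * k)) ⟩
    a ^ (k + (n % k + q * k)) % M                     ≡⟨ cong (_% M) (^-distribˡ-+-* a k _) ⟩
    (a ^ k * a ^ (n % k + q * k)) % M                 ≡⟨ %-distribˡ-* (a ^ k) _ M ⟩
    (a ^ k % M * (a ^ (n % k + q * k) % M)) % M       ≡⟨ cong (λ i → (i * (a ^ (n % k + q * k) % M)) % M) h ⟩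
    (1 % M * (a ^ (n % k + q * k) % M)) % M           ≡⟨ %-distribˡ-* 1 (a ^ (n % k + q * k)) M ⟨
    (1 * a ^ (n % k + q * k)) % M                     ≡⟨ cong (_% M) (*-identityˡ (a ^ (n % k + q * k))) ⟩
    a ^ (n % k + q * k) % M                           ≡⟨ go q ⟩
    a ^ (n % k) % M                                   ∎
    where
    rearrange : ∀ x y z → x + (y + z) ≡ y + (x + z)
    rearrange = solve-∀

∣m+n∣n⇒∣m : ∀ {i m n} → i ∣ m + n → i ∣ n → i ∣ m
∣m+n∣n⇒∣m {i} {m} {n} d = ∣m+n∣m⇒∣n (subst (i ∣_) (+-comm m n) d)

prime∣^⇒∣ : ∀ {p} → Prime p → ∀ q n → p ∣ q ^ n → p ∣ q
prime∣^⇒∣ pr q zero d = ∣-trans d (1∣ q)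
prime∣^⇒∣ pr q (suc n) d with euclidsLemma q (q ^ n) pr d
... | inj₁ d′ = d′
... | inj₂ d′ = prime∣^⇒∣ pr q n d′

prime-∤-* : ∀ {p a b} → Prime p → ¬ p ∣ a → ¬ p ∣ b → ¬ p ∣ a * b
prime-∤-* {a = a} {b} pr na nb d = [ na , nb ]′ (euclidsLemma a b pr d)

prime5 : Prime 5
prime5 = from-yes (prime? 5)

¬2∣3^ : ∀ n → ¬ 2 ∣ 3 ^ n
¬2∣3^ n d = from-no (2 ∣? 3) (prime∣^⇒∣ prime2 3 n d)

¬3∣2^ : ∀ n → ¬ 3 ∣ 2 ^ n
¬3∣2^ n d = from-no (3 ∣? 2) (prime∣^⇒∣ prime3 2 n d)

+-% : ∀ M .{{_ : NonZero M}} {a} b c → a ≡ b + c → a % M ≡ (b % M + c % M) % M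
+-% M b c refl = %-distribˡ-+ b c M

-- Doubling and tripling ndh-numbers; the multiples of 41.

-- If both harmonic numbers are even, halving them represents `x`; if exactly one is, parity fails.
2x-difference : ∀ {x a b c d} → NDH x → 2 ^ a * 3 ^ b ≡ 2 * x + 2 ^ c * 3 ^ d → 3 ^ b ≡ 2 * x + 3 ^ d
2x-difference {x} {suc a} {b} {suc c} {d} (_ , ndh) eq = contradiction
  (_ , _ , (a , b , refl) , (c , d , refl) , *-cancelˡ-≡ _ _ 2 (trans (sym (*-assoc 2 (2 ^ a) (3 ^ b))) (trans eq (identity x (2 ^ c) (3 ^ d))))) ndh
  where
  identity : ∀ x c d → 2 * x + 2 * c * d ≡ 2 * (x + c * d)
  identity = solve-∀
2x-difference {x} {suc a} {b} {zero} {d} _ eq = contradiction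
  (∣m+n∣m⇒∣n (subst (2 ∣_) eq (∣m⇒∣m*n (3 ^ b) (m∣m*n (2 ^ a)))) (m∣m*n x)) (λ d2 → ¬2∣3^ d (subst (2 ∣_) (*-identityˡ _) d2))
2x-difference {x} {zero} {b} {suc c} {d} _ eq = contradiction
  (subst (2 ∣_) (trans (sym eq) (*-identityˡ _)) (∣m∣n⇒∣m+n (m∣m*n x) (∣m⇒∣m*n (3 ^ d) (m∣m*n (2 ^ c))))) (¬2∣3^ b)
2x-difference {x} {zero} {b} {zero} {d} _ eq = trans (sym (*-identityˡ _)) (trans eq (cong (2 * x +_) (*-identityˡ _)))

3x-difference : ∀ {x a b c d} → NDH x → 2 ^ a * 3 ^ b ≡ 3 * x + 2 ^ c * 3 ^ d → 2 ^ a ≡ 3 * x + 2 ^ c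
3x-difference {x} {a} {suc b} {c} {suc d} (_ , ndh) eq = contradiction
  (_ , _ , (a , b , refl) , (c , d , refl) , *-cancelˡ-≡ _ _ 3 (trans (id₁ (2 ^ a) (3 ^ b)) (trans eq (id₂ x (2 ^ c) (3 ^ d))))) ndh
  where
  id₁ : ∀ a b → 3 * (a * b) ≡ a * (3 * b)
  id₁ = solve-∀
  id₂ : ∀ x c d → 3 * x + c * (3 * d) ≡ 3 * (x + c * d)
  id₂ = solve-∀
3x-difference {x} {a} {suc b} {c} {zero} _ eq = contradiction
  (∣m+n∣m⇒∣n (subst (3 ∣_) eq (∣n⇒∣m*n (2 ^ a) (m∣m*n (3 ^ b)))) (m∣m*n x)) (λ d3 → ¬3∣2^ c (subst (3 ∣_) (*-identityʳ _) d3))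
3x-difference {x} {a} {zero} {c} {suc d} _ eq = contradiction
  (subst (3 ∣_) (trans (sym eq) (*-identityʳ _)) (∣m∣n⇒∣m+n (m∣m*n x) (∣n⇒∣m*n (2 ^ c) (m∣m*n (3 ^ d))))) (¬3∣2^ a)
3x-difference {x} {a} {zero} {c} {zero} _ eq = trans (sym (*-identityʳ _)) (trans eq (cong (3 * x +_) (*-identityʳ _)))

NDH-2* : ∀ {x} → NDH x → (∀ b d → ¬ (3 ^ b ≡ 2 * x + 3 ^ d)) → NDH (2 * x)
NDH-2* {x} nx@(0<x , _) no-diff = *-mono-≤ {1} {2} (s≤s z≤n) 0<x ,
  λ { (_ , _ , (a , b , refl) , (c , d , refl) , eq) → no-diff b d (2x-difference {x} {a} {b} {c} {d} nx eq) }

NDH-3* : ∀ {x} → NDH x → (∀ a c → ¬ (2 ^ a ≡ 3 * x + 2 ^ c)) → NDH (3 * x)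
NDH-3* {x} nx@(0<x , _) no-diff = *-mono-≤ {1} {3} (s≤s z≤n) 0<x ,
  λ { (_ , _ , (a , b , refl) , (c , d , refl) , eq) → no-diff a c (3x-difference {x} {a} {b} {c} {d} nx eq) }

-- 3 has order 8 and 2 has order 20 modulo 41, and 5 divides 3⁸ − 1 and 2²⁰ − 1.
3^b≢2^n41+3^d : ∀ n b d → ¬ (3 ^ b ≡ 2 ^ n * 41 + 3 ^ d)
3^b≢2^n41+3^d n zero d eq = <-irrefl eq (≤-trans (s≤s (s≤s z≤n)) (≤-trans (m≤n*m 41 (2 ^ n) {{m^n≢0 2 n}}) (m≤m+n _ (3 ^ d))))
3^b≢2^n41+3^d n (suc b) (suc d) eq = prime-∤-* prime3 (¬3∣2^ n) (from-no (3 ∣? 41))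
  (∣m+n∣n⇒∣m (subst (3 ∣_) eq (m∣m*n (3 ^ b))) (m∣m*n (3 ^ d)))
3^b≢2^n41+3^d n b@(suc _) zero eq =
  prime-∤-* prime5 (λ d5 → from-no (5 ∣? 2) (prime∣^⇒∣ prime5 2 n d5)) (from-no (5 ∣? 41)) 5∣
  where
  mod41 : 3 ^ (b % 8) % 41 ≡ 1
  mod41 = trans (sym (^-% 3 8 41 refl b)) (trans (cong (_% 41) (trans eq (+-comm (2 ^ n * 41) 1))) ([m+kn]%n≡m%n 1 (2 ^ n) 41))
  mod5 : 3 ^ b % 5 ≡ 1
  mod5 = trans (^-% 3 8 5 refl b) (from-yes (allUpTo? (λ i → (3 ^ i % 41 ≟ 1) →-dec (3 ^ i % 5 ≟ 1)) 8) (m%n<n b 8) mod41)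
  5∣ : 5 ∣ 2 ^ n * 41
  5∣ = divides (3 ^ b / 5) (+-cancelʳ-≡ 1 _ _ (trans (sym eq) (trans (m≡m%n+[m/n]*n (3 ^ b) 5) (trans (cong (_+ 3 ^ b / 5 * 5) mod5) (+-comm 1 _)))))

2^a≢3^n41+2^c : ∀ n a c → ¬ (2 ^ a ≡ 3 ^ n * 41 + 2 ^ c)
2^a≢3^n41+2^c n zero c eq = <-irrefl eq (≤-trans (s≤s (s≤s z≤n)) (≤-trans (m≤n*m 41 (3 ^ n) {{m^n≢0 3 n}}) (m≤m+n _ (2 ^ c))))
2^a≢3^n41+2^c n (suc a) (suc c) eq = prime-∤-* prime2 (¬2∣3^ n) (from-no (2 ∣? 41))
  (∣m+n∣n⇒∣m (subst (2 ∣_) eq (m∣m*n (2 ^ a))) (m∣m*n (2 ^ c)))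
2^a≢3^n41+2^c n a@(suc _) zero eq =
  prime-∤-* prime5 (λ d5 → from-no (5 ∣? 3) (prime∣^⇒∣ prime5 3 n d5)) (from-no (5 ∣? 41)) 5∣
  where
  mod41 : 2 ^ (a % 20) % 41 ≡ 1
  mod41 = trans (sym (^-% 2 20 41 refl a)) (trans (cong (_% 41) (trans eq (+-comm (3 ^ n * 41) 1))) ([m+kn]%n≡m%n 1 (3 ^ n) 41))
  mod5 : 2 ^ a % 5 ≡ 1
  mod5 = trans (^-% 2 20 5 refl a) (from-yes (allUpTo? (λ i → (2 ^ i % 41 ≟ 1) →-dec (2 ^ i % 5 ≟ 1)) 20) (m%n<n a 20) mod41)
  5∣ : 5 ∣ 3 ^ n * 41
  5∣ = divides (2 ^ a / 5) (+-cancelʳ-≡ 1 _ _ (trans (sym eq) (trans (m≡m%n+[m/n]*n (2 ^ a) 5) (trans (cong (_+ 2 ^ a / 5 * 5) mod5) (+-comm 1 _)))))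

NDH-2^n41 : NDH 41 → ∀ n → NDH (2 ^ n * 41)
NDH-2^n41 ndh41 zero = ndh41
NDH-2^n41 ndh41 (suc n) = subst NDH (sym (*-assoc 2 (2 ^ n) 41)) (NDH-2* (NDH-2^n41 ndh41 n)
  λ b d eq → 3^b≢2^n41+3^d (suc n) b d (trans eq (cong (_+ 3 ^ d) (sym (*-assoc 2 (2 ^ n) 41)))))

NDH-3^n41 : NDH 41 → ∀ n → NDH (3 ^ n * 41)
NDH-3^n41 ndh41 zero = ndh41
NDH-3^n41 ndh41 (suc n) = subst NDH (sym (*-assoc 3 (3 ^ n) 41)) (NDH-3* (NDH-3^n41 ndh41 n)
  λ a c eq → 2^a≢3^n41+2^c (suc n) a c (trans eq (cong (_+ 2 ^ c) (sym (*-assoc 3 (3 ^ n) 41)))))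

-- Primes congruent to 41 modulo 48.

^-square : ∀ a n → a ^ (n * 2) ≡ a ^ n * a ^ n
^-square a n = trans (sym (^-*-assoc a n 2)) (cong (a ^ n *_) (*-identityʳ (a ^ n)))

module _ {p : ℕ} (pr : Prime p) (p%48 : p % 48 ≡ 41) where
  p% : ∀ m .{{_ : NonZero m}} → m ∣ 48 → p % m ≡ 41 % m
  p% m d = trans (sym (m∣n⇒o%n%m≡o%m m 48 p d)) (cong (_% m) p%48)

  41≤p : 41 ≤ p
  41≤p = subst (41 ≤_) (trans (cong (_+ p / 48 * 48) (sym p%48)) (sym (m≡m%n+[m/n]*n p 48))) (m≤m+n 41 _)

  ¬∣p : ∀ m .{{_ : NonZero m}} → m ∣ 48 → ¬ (41 % m ≡ 0) → ¬ m ∣ p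
  ¬∣p m d48 ne d = ne (trans (sym (p% m d48)) (n∣m⇒m%n≡0 p m d))

  ¬2∣p : ¬ 2 ∣ p
  ¬2∣p = ¬∣p 2 (divides 24 refl) λ ()

  ¬3∣p : ¬ 3 ∣ p
  ¬3∣p = ¬∣p 3 (divides 16 refl) λ ()

  sum-mod16 : ∀ {h} b → h ≡ p + 3 ^ b → h % 16 ≡ (9 + 3 ^ (b % 4) % 16) % 16
  sum-mod16 b eq = trans (+-% 16 p (3 ^ b) eq) (cong₂ (λ x y → (x + y) % 16) (p% 16 (divides 3 refl)) (^-% 3 4 16 refl b))

  -- A power of 2 that is at least 41 is divisible by 16, whereas modulo 16 `p` is 9 and a power of
  -- 3 is 1, 3, 9 or 11.
  2^a≢p+3^d : ∀ a d → ¬ (2 ^ a ≡ p + 3 ^ d)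
  2^a≢p+3^d a d eq = large a (≤-trans 41≤p (subst (p ≤_) (sym eq) (m≤m+n p (3 ^ d)))) (sum-mod16 d eq)
    where
    large : ∀ a → 41 ≤ 2 ^ a → ¬ (2 ^ a % 16 ≡ (9 + 3 ^ (d % 4) % 16) % 16)
    large 0 le = contradiction le (from-no (41 ≤? 1))
    large 1 le = contradiction le (from-no (41 ≤? 2))
    large 2 le = contradiction le (from-no (41 ≤? 4))
    large 3 le = contradiction le (from-no (41 ≤? 8))
    large (suc (suc (suc (suc a)))) _ h = from-yes (allUpTo? (λ i → ¬? (0 ≟ (9 + 3 ^ i % 16) % 16)) 4) (m%n<n d 4)
      (trans (sym (trans (cong (_% 16) (^-distribˡ-+-* 2 4 a)) (n∣m⇒m%n≡0 _ 16 (m∣m*n (2 ^ a))))) h)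

  -- Modulo 16 the right side is 10, even but not a multiple of 4, so `a` would be 1; but
  -- `2 * 3 ^ b` is only ever 2 or 6.
  2^a3^b≢p+1 : ∀ a b → ¬ (2 ^ a * 3 ^ b ≡ p + 1)
  2^a3^b≢p+1 a b eq = go a (trans (sum-mod16 0 eq) refl)
    where
    go : ∀ a → ¬ ((2 ^ a * 3 ^ b) % 16 ≡ 10)
    go 0 h = from-yes (allUpTo? (λ i → ¬? ((1 * (3 ^ i % 16)) % 16 ≟ 10)) 4) (m%n<n b 4)
      (trans (cong (λ i → (1 * i) % 16) (sym (^-% 3 4 16 refl b))) (trans (sym (%-distribˡ-* 1 (3 ^ b) 16)) h))
    go 1 h = from-yes (allUpTo? (λ i → ¬? ((2 * (3 ^ i % 16)) % 16 ≟ 10)) 4) (m%n<n b 4)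
      (trans (cong (λ i → (2 * i) % 16) (sym (^-% 3 4 16 refl b))) (trans (sym (%-distribˡ-* 2 (3 ^ b) 16)) h))
    go (suc (suc a)) h = contradiction
      (trans (sym (n∣m⇒m%n≡0 _ 4 (∣m⇒∣m*n (3 ^ b) (subst (4 ∣_) (sym (^-distribˡ-+-* 2 2 a)) (m∣m*n (2 ^ a))))))
        (trans (sym (m∣n⇒o%n%m≡o%m 4 16 (2 ^ suc (suc a) * 3 ^ b) (divides 4 refl))) (cong (_% 4) h))) λ ()

  -- Congruences modulo 3 and 16 make both exponents even, so the prime `p` is a difference of
  -- squares u² - w² and u is w + 1, which fails modulo 4.
  3^b≢p+2^c : ∀ b c → ¬ (3 ^ suc b ≡ p + 2 ^ suc c)
  3^b≢p+2^c b c eq = even-exponent ((suc c) / 2) (trans (m≡m%n+[m/n]*n (suc c) 2) (cong (_+ suc c / 2 * 2) c-even))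
    where
    c-even : suc c % 2 ≡ 0
    c-even = from-yes (allUpTo? (λ i → (0 ≟ (2 + 2 ^ i % 3) % 3) →-dec (i ≟ 0)) 2) (m%n<n (suc c) 2)
      (trans (sym (n∣m⇒m%n≡0 (3 ^ suc b) 3 (m∣m*n (3 ^ b))))
        (trans (+-% 3 p (2 ^ suc c) eq) (cong₂ (λ x y → (x + y) % 3) (p% 3 (divides 16 refl)) (^-% 2 2 3 refl (suc c)))))
    mod16 : ∀ j → suc c ≡ j → 3 ^ (suc b % 4) % 16 ≡ (9 + 2 ^ j % 16) % 16
    mod16 j refl = trans (sym (^-% 3 4 16 refl (suc b))) (trans (+-% 16 p (2 ^ suc c) eq) (cong (λ x → (x + 2 ^ suc c % 16) % 16) (p% 16 (divides 3 refl))))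
    even-exponent : ∀ j → suc c ≡ j * 2 → ⊥
    even-exponent 0 ()
    -- The power 4 does not vanish modulo 16 and is treated apart: 9 + 4 is no power of 3 modulo 16.
    even-exponent 1 refl = from-yes (allUpTo? (λ i → ¬? (3 ^ i % 16 ≟ 13)) 4) (m%n<n (suc b) 4) (mod16 2 refl)
    even-exponent (suc (suc j)) c≡ = factor (m≤n⇒∃[o]m+o≡n w≤u)
      where
      k w u : ℕ
      k = suc b / 4
      w = 2 ^ suc (suc j)
      u = 3 ^ suc (k * 2)
      -- Modulo 16 the power of 2 vanishes, so `3 ^ suc b` is 9 and `suc b` is 2 modulo 4. Thus `u`
      -- is an odd power of 3.
      b≡ : suc b ≡ suc (k * 2) * 2
      b≡ = trans (m≡m%n+[m/n]*n (suc b) 4) (trans (cong (_+ k * 4)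
          (from-yes (allUpTo? (λ i → (3 ^ i % 16 ≟ 9) →-dec (i ≟ 2)) 4) (m%n<n (suc b) 4)
            (trans (mod16 (suc (suc j) * 2) c≡) (cong (λ x → (9 + x) % 16) (trans (cong (_% 16) (^-distribˡ-+-* 2 4 (j * 2))) (n∣m⇒m%n≡0 _ 16 (m∣m*n (2 ^ (j * 2)))))))))
          (identity k))
        where
        identity : ∀ k → 2 + k * 4 ≡ suc (k * 2) * 2
        identity = solve-∀
      squares : u * u ≡ p + w * w
      squares = trans (sym (trans (cong (3 ^_) b≡) (^-square 3 (suc (k * 2))))) (trans eq (cong (p +_) (trans (cong (2 ^_) c≡) (^-square 2 (suc (suc j))))))
      w≤u : w ≤ u
      w≤u = ≮⇒≥ λ u<w → <-irrefl squares (<-≤-trans (*-mono-< u<w u<w) (m≤n+m (w * w) p))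
      p≡ : ∀ g → w + g ≡ u → p ≡ (2 * w + g) * g
      p≡ g w+g≡u = sym (+-cancelʳ-≡ (w * w) _ _ (trans (identity w g) (trans (cong (λ x → x * x) w+g≡u) squares)))
        where
        identity : ∀ w g → (2 * w + g) * g + w * w ≡ (w + g) * (w + g)
        identity = solve-∀
      factor : ¬ (∃[ g ] w + g ≡ u)
      factor (g , w+g≡u) = [ g≢1 , g≢p ]′ (prime⇒irreducible pr (divides (2 * w + g) (p≡ g w+g≡u)))
        where
        -- `w` is a multiple of 4, while `u`, an odd power of 3, is 3 modulo 4.
        g≢1 : ¬ (g ≡ 1)
        g≢1 refl = from-yes (allUpTo? (λ i → ¬? ((0 + 1) % 4 ≟ (3 * (9 ^ i % 4)) % 4)) 1) (m%n<n k 1)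
          (trans (trans (cong (λ x → (x + 1) % 4) (sym (n∣m⇒m%n≡0 w 4 (subst (4 ∣_) (sym (^-distribˡ-+-* 2 2 j)) (m∣m*n (2 ^ j)))))) (sym (%-distribˡ-+ w 1 4)))
            (trans (cong (_% 4) w+g≡u) (trans (%-distribˡ-* 3 (3 ^ (k * 2)) 4) (cong (λ x → (3 * x) % 4)
              (trans (cong (λ i → 3 ^ i % 4) (*-comm k 2)) (trans (cong (_% 4) (sym (^-*-assoc 3 2 k))) (^-% 9 1 4 refl k)))))))
        g≢p : ¬ (g ≡ p)
        g≢p refl = <-irrefl (trans (p≡ p w+g≡u) (*-comm (2 * w + p) p)) (m<m*n p (2 * w + p) {{>-nonZero (≤-trans (s≤s z≤n) 41≤p)}} (≤-trans (≤-trans (s≤s (s≤s z≤n)) 41≤p) (m≤n+m p (2 * w))))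

  NDH-prime : NDH p
  NDH-prime = ≤-trans (s≤s z≤n) 41≤p , λ { (_ , _ , (a , b , refl) , (c , d , refl) , eq) → go a b c d eq }
    where
    -- A common factor 2 or 3 would divide `p`, two odd numbers have an even difference, and 1 is
    -- too small to be the larger number. What survives is a power of 2 minus a power of 3, a
    -- harmonic number minus 1, and a power of 3 minus a power of 2.
    go : ∀ a b c d → ¬ (2 ^ a * 3 ^ b ≡ p + 2 ^ c * 3 ^ d)
    go (suc a) b (suc c) d eq = ¬2∣p (∣m+n∣n⇒∣m (subst (2 ∣_) eq (∣m⇒∣m*n (3 ^ b) (m∣m*n (2 ^ a)))) (∣m⇒∣m*n (3 ^ d) (m∣m*n (2 ^ c))))
    go zero b zero d eq = from-yes (allUpTo? (λ i → allUpTo? (λ j → ¬? (3 ^ i % 2 ≟ (1 + 3 ^ j % 2) % 2)) 1) 1) (m%n<n b 1) (m%n<n d 1)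
      (trans (sym (^-% 3 1 2 refl b)) (trans (+-% 2 p (3 ^ d) (trans (sym (*-identityˡ _)) (trans eq (cong (p +_) (*-identityˡ _)))))
        (cong₂ (λ x y → (x + y) % 2) (p% 2 (divides 24 refl)) (^-% 3 1 2 refl d))))
    go (suc a) (suc b) zero (suc d) eq = ¬3∣p (∣m+n∣n⇒∣m (subst (3 ∣_) eq (∣n⇒∣m*n (2 ^ suc a) (m∣m*n (3 ^ b)))) (∣n⇒∣m*n 1 (m∣m*n (3 ^ d))))
    go (suc a) zero zero d eq = 2^a≢p+3^d (suc a) d (trans (sym (*-identityʳ _)) (trans eq (cong (p +_) (*-identityˡ _))))
    go (suc a) (suc b) zero zero eq = 2^a3^b≢p+1 (suc a) (suc b) eq
    go zero zero (suc c) d eq = <-irrefl eq (≤-trans (≤-trans (s≤s (s≤s z≤n)) 41≤p) (m≤m+n p _))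
    go zero (suc b) (suc c) (suc d) eq = ¬3∣p (∣m+n∣n⇒∣m (subst (3 ∣_) eq (∣n⇒∣m*n 1 (m∣m*n (3 ^ b)))) (∣n⇒∣m*n (2 ^ suc c) (m∣m*n (3 ^ d))))
    go zero (suc b) (suc c) zero eq = 3^b≢p+2^c b c (trans (sym (*-identityˡ _)) (trans eq (cong (p +_) (*-identityʳ _))))

-- Numbers that are differences both of powers of 2 and of powers of 3.

-- Modulo `M` the term `y` disappears and `a ^ c` cancels, leaving `a ^ n` equal to 1. Exponents
-- matter only modulo 2, so `check` is a finite verification, carried out for 2 modulo 3 and for 3
-- modulo 8.
even-exponent : ∀ a M .{{_ : NonZero M}} → a ^ 2 % M ≡ 1 % M →
  (∀ {i} → i < 2 → ∀ {j} → j < 2 → (a ^ i % M * (a ^ j % M)) % M ≡ (0 + a ^ i % M) % M → j ≡ 0) →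
  ∀ {y} c n → M ∣ y → a ^ c * a ^ n ≡ y + a ^ c → n ≡ n / 2 * 2
even-exponent a M h check {y} c n d eq = trans (m≡m%n+[m/n]*n n 2) (cong (_+ n / 2 * 2) (check (m%n<n c 2) (m%n<n n 2) (begin
  (a ^ (c % 2) % M * (a ^ (n % 2) % M)) % M  ≡⟨ cong₂ (λ x y → (x * y) % M) (^-% a 2 M h c) (^-% a 2 M h n) ⟨
  (a ^ c % M * (a ^ n % M)) % M              ≡⟨ %-distribˡ-* (a ^ c) (a ^ n) M ⟨
  (a ^ c * a ^ n) % M                        ≡⟨ +-% M y (a ^ c) eq ⟩
  (y % M + a ^ c % M) % M                    ≡⟨ cong₂ (λ x y → (x + y) % M) (n∣m⇒m%n≡0 y M d) (^-% a 2 M h c) ⟩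
  (0 + a ^ (c % 2) % M) % M                  ∎)))
  where open ≡-Reasoning

exponent-gap : ∀ a .{{_ : NonZero a}} {y} A C → 0 < y → a ^ A ≡ y + a ^ C → ∃[ n ] C + n ≡ A
exponent-gap a A C 0<y eq = m≤n⇒∃[o]m+o≡n (<⇒≤ (≰⇒> λ A≤C →
  <-irrefl eq (≤-<-trans (^-monoʳ-≤ a A≤C) (m<n+m (a ^ C) 0<y))))

-- Once 16 divides the power of 2, `3 ^ b` is 1 modulo 16, so 4 divides `b` and `3 ^ b` is 1 modulo
-- 5 as well; then 5 would divide a power of 2.
consecutive : ∀ a b → 3 ^ b ≡ 2 ^ suc a + 1 → 2 ^ suc a ≡ 2 ⊎ 2 ^ suc a ≡ 8
consecutive 0 b eq = inj₁ refl
consecutive 1 b eq = contradiction (trans (sym (^-% 3 2 8 refl b)) (cong (_% 8) eq))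
  (from-yes (allUpTo? (λ i → ¬? (3 ^ i % 8 ≟ 5)) 2) (m%n<n b 2))
consecutive 2 b eq = inj₂ refl
consecutive (suc (suc (suc a))) b eq = contradiction
  (trans (cong (λ x → (x + 1) % 5) (sym (^-% 2 4 5 refl (4 + a)))) (trans (sym (+-% 5 (2 ^ (4 + a)) 1 eq)) mod5))
  (from-yes (allUpTo? (λ i → ¬? ((2 ^ i % 5 + 1) % 5 ≟ 1)) 4) (m%n<n (4 + a) 4))
  where
  mod16 : 3 ^ (b % 4) % 16 ≡ 1
  mod16 = trans (sym (^-% 3 4 16 refl b)) (trans (+-% 16 (2 ^ (4 + a)) 1 eq)
    (cong (λ x → (x + 1) % 16) (n∣m⇒m%n≡0 (2 ^ (4 + a)) 16 (subst (16 ∣_) (sym (^-distribˡ-+-* 2 4 a)) (m∣m*n (2 ^ a))))))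
  mod5 : 3 ^ b % 5 ≡ 1
  mod5 = trans (^-% 3 4 5 refl b) (from-yes (allUpTo? (λ i → (3 ^ i % 16 ≟ 1) →-dec (3 ^ i % 5 ≟ 1)) 4) (m%n<n b 4) mod16)

8∣2^ : ∀ k → 8 ∣ 2 ^ (3 + k)
8∣2^ k = subst (8 ∣_) (sym (^-distribˡ-+-* 2 3 k)) (m∣m*n (2 ^ k))

-- Powers of 3 are 1 or 3 modulo 8, so `e` is 7 or 5 modulo 8.
5≤2^-3^ : ∀ k d e → 2 ^ (3 + k) ≡ 3 ^ d + e → 5 ≤ e
5≤2^-3^ k d e eq = ≮⇒≥ λ e<5 →
  from-yes (allUpTo? (λ i → allUpTo? (λ e → ¬? ((3 ^ i % 8 + e % 8) % 8 ≟ 0)) 5) 2) (m%n<n d 2) e<5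
    (trans (cong (λ x → (x + e % 8) % 8) (sym (^-% 3 2 8 refl d))) (trans (sym (+-% 8 (3 ^ d) e eq)) (n∣m⇒m%n≡0 (2 ^ (3 + k)) 8 (8∣2^ k))))

module _ {y : ℕ} (0<y : 0 < y) where
  nonzero-gap : ∀ a c → ¬ (a ^ (c + 0) ≡ y + a ^ c)
  nonzero-gap a c eq = <-irrefl (trans (cong (a ^_) (sym (+-identityʳ c))) eq) (m<n+m (a ^ c) 0<y)

  -- The larger powers differ by the same `e` as the smaller ones. Gap 0 contradicts parity; gap 1
  -- leaves only the pairs 2, 3 and 8, 9, so `y` is 8 - 2. For larger gaps `y` is a multiple of 3,
  -- hence `n` is even and `3-difference-unique` applies.
  3-above : ∀ C D n m e → 2 ^ (suc C + n) ≡ y + 2 ^ suc C → 3 ^ (suc D + m) ≡ y + 3 ^ suc D →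
    2 ^ suc C + e ≡ 3 ^ suc D → y ≡ 6
  3-above C D n m zero eq₂ eq₃ ee = contradiction (subst (2 ∣_) (trans (sym (+-identityʳ _)) ee) (m∣m*n (2 ^ C))) (¬2∣3^ (suc D))
  3-above C D n m 1 eq₂ eq₃ ee with consecutive C (suc D) (sym ee) | consecutive (C + n) (suc D + m)
      (trans eq₃ (trans (cong (y +_) (sym ee)) (trans (sym (+-assoc y (2 ^ suc C) 1)) (cong (_+ 1) (sym eq₂)))))
  ... | inj₁ p | inj₁ q = contradiction (trans (sym q) (trans eq₂ (cong (y +_) p))) λ eq → <-irrefl eq (m<n+m 2 0<y)
  ... | inj₁ p | inj₂ q = +-cancelʳ-≡ 2 y 6 (sym (trans (sym q) (trans eq₂ (cong (y +_) p))))
  ... | inj₂ p | inj₁ q = contradiction (trans (sym q) (trans eq₂ (cong (y +_) p))) λ eq → <-irrefl eq (<-≤-trans (s≤s (s≤s (s≤s z≤n))) (m≤n+m 8 y))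
  ... | inj₂ p | inj₂ q = contradiction (trans (sym q) (trans eq₂ (cong (y +_) p))) λ eq → <-irrefl eq (m<n+m 8 0<y)
  3-above C D n m e@(suc (suc _)) eq₂ eq₃ ee = even (n / 2) (even-exponent 2 3 refl
      (from-yes (allUpTo? (λ i → allUpTo? (λ j → ((2 ^ i % 3 * (2 ^ j % 3)) % 3 ≟ (0 + 2 ^ i % 3) % 3) →-dec (j ≟ 0)) 2) 2))
      {y} (suc C) n (∣m+n∣n⇒∣m (subst (3 ∣_) eq₃ (m∣m*n (3 ^ (D + m)))) (m∣m*n (3 ^ D)))
      (trans (sym (^-distribˡ-+-* 2 (suc C) n)) eq₂))
    where
    even : ∀ r → n ≡ r * 2 → y ≡ 6
    even zero refl = contradiction eq₂ (nonzero-gap 2 (suc C))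
    even (suc r) n≡ = contradiction
      (trans eq₃ (trans (cong (y +_) (sym ee)) (trans (sym (+-assoc y (2 ^ suc C) e)) (cong (_+ e) (trans (sym eq₂)
        (trans (^-distribˡ-+-* 2 (suc C) n) (cong (2 ^ suc C *_) (trans (cong (2 ^_) n≡) (^-square 2 (suc r))))))))))
      (3-difference-unique C D (D + m) r e (s≤s (s≤s z≤n)) (sym ee))

  -- The smaller power of 2 is at least 8: 2 is below 3, and 4 would leave a gap below 5 although
  -- the larger powers require at least 5. Then 8 divides `y`, so `m` is even and
  -- `2-difference-solutions` applies.
  2-above : ∀ C D n m e → 2 ^ (suc C + n) ≡ y + 2 ^ suc C → 3 ^ (suc D + m) ≡ y + 3 ^ suc D →
    3 ^ suc D + e ≡ 2 ^ suc C → y ≡ 24 ⊎ y ≡ 240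
  2-above C D zero m e eq₂ _ _ = contradiction eq₂ (nonzero-gap 2 (suc C))
  2-above zero D (suc n) m e eq₂ eq₃ ee = contradiction ee λ eq → <-irrefl (sym eq)
    (<-≤-trans (s≤s (s≤s (s≤s z≤n))) (≤-trans (*-monoʳ-≤ 3 (m^n>0 3 D)) (m≤m+n (3 ^ suc D) e)))
  2-above 1 D (suc n) m e eq₂ eq₃ ee = contradiction
    (5≤2^-3^ n (suc D + m) e (trans (cong (2 ^_) (sym (+-suc 2 n))) (trans eq₂ (trans (cong (y +_) (sym ee))
      (trans (sym (+-assoc y (3 ^ suc D) e)) (cong (_+ e) (sym eq₃)))))))
    (<⇒≱ (≤-<-trans (≤-trans (m≤n+m e (3 ^ suc D)) (≤-reflexive ee)) (s≤s (s≤s (s≤s (s≤s (s≤s z≤n)))))))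
  2-above (suc (suc C)) D n@(suc _) m e eq₂ eq₃ ee = even (m / 2) (even-exponent 3 8 refl
      (from-yes (allUpTo? (λ i → allUpTo? (λ j → ((3 ^ i % 8 * (3 ^ j % 8)) % 8 ≟ (0 + 3 ^ i % 8) % 8) →-dec (j ≟ 0)) 2) 2))
      {y} (suc D) m (∣m+n∣n⇒∣m (subst (8 ∣_) eq₂ (8∣2^ (C + n))) (8∣2^ C))
      (trans (sym (^-distribˡ-+-* 3 (suc D) m)) eq₃))
    where
    even : ∀ r → m ≡ r * 2 → y ≡ 24 ⊎ y ≡ 240
    even zero refl = contradiction eq₃ (nonzero-gap 3 (suc D))
    even (suc r) m≡ = conclude (2-difference-solutions C (C + n) D r e (5≤2^-3^ C (suc D) e (sym ee)) (sym ee) 2^A≡)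
      where
      3^B≡ : 3 ^ (suc D + m) ≡ 3 ^ suc D * (3 ^ suc r * 3 ^ suc r)
      3^B≡ = trans (^-distribˡ-+-* 3 (suc D) m) (cong (3 ^ suc D *_) (trans (cong (3 ^_) m≡) (^-square 3 (suc r))))
      2^A≡ : 2 ^ (3 + (C + n)) ≡ 3 ^ suc D * (3 ^ suc r * 3 ^ suc r) + e
      2^A≡ = trans eq₂ (trans (cong (y +_) (sym ee)) (trans (sym (+-assoc y (3 ^ suc D) e)) (cong (_+ e) (trans (sym eq₃) 3^B≡))))
      conclude : D ≡ 0 × e ≡ 5 × r ≡ 0 ⊎ D ≡ 0 × e ≡ 13 × r ≡ 1 → y ≡ 24 ⊎ y ≡ 240
      -- The two values of `y` are 27 - 3 and 243 - 3.
      conclude (inj₁ (refl , refl , refl)) = inj₁ (+-cancelʳ-≡ 3 y 24 (trans (sym eq₃) 3^B≡))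
      conclude (inj₂ (refl , refl , refl)) = inj₂ (+-cancelʳ-≡ 3 y 240 (trans (sym eq₃) 3^B≡))

  common-difference : ∀ A B C D → 2 ^ A ≡ y + 2 ^ suc C → 3 ^ B ≡ y + 3 ^ suc D → y ≡ 6 ⊎ y ≡ 24 ⊎ y ≡ 240
  common-difference A B C D eq₂ eq₃ with exponent-gap 2 A (suc C) 0<y eq₂ | exponent-gap 3 B (suc D) 0<y eq₃
  ... | n , refl | m , refl with ≤-total (2 ^ suc C) (3 ^ suc D)
  ...   | inj₁ le = let e , ee = m≤n⇒∃[o]m+o≡n le in inj₁ (3-above C D n m e eq₂ eq₃ ee)
  ...   | inj₂ le = let e , ee = m≤n⇒∃[o]m+o≡n le in inj₂ (2-above C D n m e eq₂ eq₃ ee)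

-- Choosing between 2x and 3x.

n<2^n : ∀ n → n < 2 ^ n
n<2^n zero = s≤s z≤n
n<2^n (suc n) = ≤-trans (+-mono-≤ (m^n>0 2 n) (n<2^n n)) (≤-reflexive (cong (2 ^ n +_) (sym (+-identityʳ (2 ^ n)))))

-- The disjunction in (iii) needs a decision, and the search is bounded: `2 ^ c` divides `y`, so `c`
-- is below `y`, and `2 ^ a` is at most `y + y`.
power-difference? : ∀ y → 0 < y → Dec (∃[ a ] ∃[ c ] 2 ^ a ≡ y + 2 ^ c)
power-difference? y 0<y with anyUpTo? (λ c → anyUpTo? (λ a → 2 ^ a ≟ y + 2 ^ c) (y + y)) y
... | yes (c , _ , a , _ , eq) = yes (a , c , eq)
... | no none = no λ { (a , c , eq) → none (c , c<y c a eq , a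
        , <-≤-trans (n<2^n a) (≤-trans (≤-reflexive eq) (+-monoʳ-≤ y (2^c≤y c a eq))) , eq) }
  where
  2^c≤y : ∀ c a → 2 ^ a ≡ y + 2 ^ c → 2 ^ c ≤ y
  2^c≤y c a eq with exponent-gap 2 a c 0<y eq
  ... | n , refl = ∣⇒≤ {{>-nonZero 0<y}} (∣m+n∣n⇒∣m (subst (2 ^ c ∣_) (trans (sym (^-distribˡ-+-* 2 c n)) eq) (m∣m*n (2 ^ n))) ∣-refl)
  c<y : ∀ c a → 2 ^ a ≡ y + 2 ^ c → c < y
  c<y c a eq = <-≤-trans (n<2^n c) (2^c≤y c a eq)

NDH-2*⊎3* : ∀ x → NDH x → NDH (2 * x) ⊎ NDH (3 * x)
NDH-2*⊎3* x nx@(0<x , ndh) with power-difference? (3 * x) (*-mono-≤ {1} {3} (s≤s z≤n) 0<x)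
... | no none = inj₂ (NDH-3* nx λ a c eq → none (a , c , eq))
-- Doubling one equation and tripling the other gives `6 * x` as a difference of both kinds with the
-- positive exponents that `common-difference` asks for.
... | yes (a , c , eq₂) = inj₁ (NDH-2* nx λ b d eq₃ → small
      (common-difference (*-mono-≤ {1} {6} (s≤s z≤n) 0<x) (suc a) (suc b) c d
        (trans (cong (2 *_) eq₂) (id₂ x (2 ^ c))) (trans (cong (3 *_) eq₃) (id₃ x (3 ^ d)))))
  where
  id₂ : ∀ x c → 2 * (3 * x + c) ≡ 6 * x + 2 * c
  id₂ = solve-∀
  id₃ : ∀ x d → 3 * (2 * x + d) ≡ 6 * x + 3 * d
  id₃ = solve-∀
  small : ¬ (6 * x ≡ 6 ⊎ 6 * x ≡ 24 ⊎ 6 * x ≡ 240)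
  small (inj₁ eq) = ndh (2 , 1 , (1 , 0 , refl) , (0 , 0 , refl) , cong (_+ 1) (sym (*-cancelˡ-≡ x 1 6 eq)))
  small (inj₂ (inj₁ eq)) = ndh (8 , 4 , (3 , 0 , refl) , (2 , 0 , refl) , cong (_+ 4) (sym (*-cancelˡ-≡ x 4 6 eq)))
  small (inj₂ (inj₂ eq)) = ndh (64 , 24 , (6 , 0 , refl) , (3 , 1 , refl) , cong (_+ 24) (sym (*-cancelˡ-≡ x 40 6 eq)))

theorem2p4 : ((n : ℕ) → NDH (2 ^ n * 41))
    × ((n : ℕ) → NDH (3 ^ n * 41))
    × ((x : ℕ) → NDH x → NDH (2 * x) ⊎ NDH (3 * x))
    × ((p : ℕ) → Prime p → p % 48 ≡ 41 → NDH p)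
theorem2p4 = NDH-2^n41 ndh41 , NDH-3^n41 ndh41 , NDH-2*⊎3* , λ p → NDH-prime
  where
  -- 41 is itself a prime of the kind in (iv), which supplies the base case of (i) and (ii).
  ndh41 : NDH 41
  ndh41 = NDH-prime (from-yes (prime? 41)) refl
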